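{- For any nonempty configuration and any integer shift $G$, the inter-level sampler (Algorithm 1) terminates with probability $1$ and returns level $\ell$ with probability exactly $W_\ell/\sum_j W_j$.
   Context: Fix an integer $b\ge 2$. There is a set $\mathcal L$ of $N$ levels, which are consecutive integers. Each level $\ell$ holds a finite (possibly empty) multiset of normalized significands, each an integer in $[2^{b-1},2^b)$. Let $z$ be the total number of stored significands over all levels; assume $z<2^b$. For each level, $SS_\ell$ is the sum of its significands (so $SS_\ell=0$ iff the level is empty); set $SS_\ell=0$ for integers $\ell\notin\mathcal L$. The level weight is $W_\ell=SS_\ell2^\ell$. For an integer global shift $G$, $A_\ell(G)=\lfloor W_\ell2^G\rfloor+1$ if $SS_\ell>0$ and $A_\ell(G)=0$ if $SS_\ell=0$; $A(G)=\sum_\ell A_\ell(G)$ and $M(G)=\sum_\ell W_\ell2^G$. The configuration is nonempty if $z\ge1$. Inter-level sampler (Algorithm 1), with shift $G$ and $A=A(G)$: it performs independent outer iterations. In an outer iteration, draw $x$ uniformly from $\{1,\dots,A\}$ and scan the levels in decreasing order starting from the largest nonempty level. At the current level $\ell$: if $x<A_\ell(G)$, return $\ell$; if $x=A_\ell(G)$, run the refinement loop for $m=1,2,\dots$: draw $r$ uniformly from $\{0,\dots,2^b-1\}$ independently, let $t=\lfloor SS_\ell 2^{\ell+G+mb}\rfloor \bmod 2^b$; if $r<t$ return $\ell$; else if $r>t$ or $\ell+G+mb\ge 0$, abandon this outer iteration and start a new one; otherwise continue with $m+1$. If $x>A_\ell(G)$, set $x\leftarrow x-A_\ell(G)$ and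 move to the next lower level. -}

module Defs where

open import Data.Nat as ℕ using (ℕ; zero; suc; _∸_; _^_)
import Data.Nat.Properties as ℕ
import Data.Nat.ListAction as ℕ
open import Data.Integer as ℤ using (ℤ; +_; -[1+_]; ∣_∣)
open import Data.Integer.DivMod using (_%ℕ_)
import Data.Integer.Properties as ℤ
open import Data.Rational as ℚ using (ℚ; 0ℚ; 1ℚ; _/_; floor)
import Data.Rational.Properties as ℚ
open import Data.Fin as Fin using (Fin; toℕ)
open import Data.List as List using (List; []; _∷_; length; allFin; reverse; dropWhile)
open import Data.List.Relation.Unary.All as All using (All)
open import Data.Product using (∃-syntax; _×_; _,_)
open import Data.Bool using (if_then_else_)
open import Relation.Nullary using (yes; no; does)
open import Relation.Unary using (Decidable)
open import Relation.Binary using (tri<; tri≈; tri>)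
open import Relation.Binary.PropositionalEquality using (_≡_; refl; sym)
open import Algebra.Properties.Monoid.Sum ℕ.+-0-monoid using () renaming (sum to sumℕ)
open import Algebra.Properties.Monoid.Sum ℚ.+-0-monoid using () renaming (sum to sumℚ)

2^n≢0 : ∀ n → ℕ.NonZero (2 ^ n)
2^n≢0 n = ℕ.m^n≢0 2 n

exp2 : ℤ → ℚ
exp2 (+ n)    = + (2 ^ n) / 1
exp2 -[1+ n ] = (+ 1 / (2 ^ suc n)) {{2^n≢0 (suc n)}}

tricho : ∀ {X : Set} → ℕ → ℕ → (lt eq gt : X) → X
tricho x y lt eq gt with ℕ.<-cmp x y
... | tri< _ _ _ = lt
... | tri≈ _ _ _ = eq
... | tri> _ _ _ = gt

_⟶_ : (ℕ → ℚ) → ℚ → Set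
a ⟶ L = ∀ ε → 0ℚ ℚ.< ε →
  ∃[ n₀ ] ∀ n → n₀ ℕ.≤ n → ℚ.∣ a n ℚ.- L ∣ ℚ.< ε

-- Finitely supported measures, as lists of (mass, point) pairs; a point may
-- occur several times, its masses then add up.
Dist : Set → Set
Dist X = List (ℚ × X)

dirac : ∀ {X} → X → Dist X
dirac x = (1ℚ , x) ∷ []

-- Uniform on {0, …, n-1}; for n = 0 this is the zero measure.
uniform : ℕ → Dist ℕ
uniform zero      = []
uniform n@(suc _) = List.map (λ k → (+ 1 / n , k)) (List.upTo n)

infixl 1 _>>=_
_>>=_ : ∀ {X Y} → Dist X → (X → Dist Y) → Dist Y
d >>= f = List.concatMap (λ (p , x) → List.map (λ (q , y) → (p ℚ.* q , y)) (f x)) d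

Pr : ∀ {X} {P : X → Set} → Decidable P → Dist X → ℚ
Pr P? []            = 0ℚ
Pr P? ((p , x) ∷ d) = (if does (P? x) then p else 0ℚ) ℚ.+ Pr P? d

sumℕ-pos : ∀ {n} (f : Fin n → ℕ) → 1 ℕ.≤ sumℕ f → ∃[ i ] 1 ℕ.≤ f i
sumℕ-pos {suc n} f 1≤Σ with f Fin.zero in eq
... | suc k = Fin.zero , ℕ.≤-trans (ℕ.s≤s ℕ.z≤n) (ℕ.≤-reflexive (sym eq))
... | zero with i , 1≤fi ← sumℕ-pos (λ i → f (Fin.suc i)) 1≤Σ = Fin.suc i , 1≤fi

sumℚ-nonNeg : ∀ {n} (f : Fin n → ℚ) → (∀ i → 0ℚ ℚ.≤ f i) → 0ℚ ℚ.≤ sumℚ f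
sumℚ-nonNeg {zero}  f 0≤f = ℚ.≤-refl
sumℚ-nonNeg {suc n} f 0≤f =
  ℚ.+-mono-≤ (0≤f Fin.zero) (sumℚ-nonNeg (λ i → f (Fin.suc i)) (λ i → 0≤f (Fin.suc i)))

sumℚ-pos : ∀ {n} (f : Fin n → ℚ) → (∀ i → 0ℚ ℚ.≤ f i) →
           ∀ i → 0ℚ ℚ.< f i → 0ℚ ℚ.< sumℚ f
sumℚ-pos f 0≤f Fin.zero    0<fi =
  ℚ.+-mono-<-≤ 0<fi (sumℚ-nonNeg (λ i → f (Fin.suc i)) (λ i → 0≤f (Fin.suc i)))
sumℚ-pos f 0≤f (Fin.suc i) 0<fi =
  ℚ.+-mono-≤-< (0≤f Fin.zero)
    (sumℚ-pos (λ i → f (Fin.suc i)) (λ i → 0≤f (Fin.suc i)) i 0<fi)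

exp2-pos : ∀ k → ℚ.Positive (exp2 k)
exp2-pos (+ n)    = ℚ.normalize-pos (2 ^ n) 1 {{_}} {{2^n≢0 n}}
exp2-pos -[1+ n ] = ℚ.normalize-pos 1 (2 ^ suc n) {{2^n≢0 (suc n)}}

scaled-nonNeg : ∀ n k → 0ℚ ℚ.≤ (+ n / 1) ℚ.* exp2 k
scaled-nonNeg n k = ℚ.nonNegative⁻¹ _
  {{ℚ.nonNeg*nonNeg⇒nonNeg (+ n / 1) {{ℚ.normalize-nonNeg n 1}}
      (exp2 k) {{ℚ.pos⇒nonNeg (exp2 k) {{exp2-pos k}}}}}}

scaled-pos : ∀ n k → .{{ℕ.NonZero n}} → 0ℚ ℚ.< (+ n / 1) ℚ.* exp2 k
scaled-pos n k = ℚ.positive⁻¹ _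
  {{ℚ.pos*pos⇒pos (+ n / 1) {{ℚ.normalize-pos n 1}} (exp2 k) {{exp2-pos k}}}}

-- The levels are the N consecutive integers lo, lo + 1, …, lo + (N - 1); the
-- index i : Fin N stands for the level lo + i. Multisets are given as lists.
record Config (b : ℕ) : Set where
  field
    lo           : ℤ
    N            : ℕ
    significands : Fin N → List ℕ
    normalized   : ∀ i → All (λ s → 2 ^ (b ∸ 1) ℕ.≤ s × s ℕ.< 2 ^ b) (significands i)

  z : ℕ
  z = sumℕ (λ i → length (significands i))

  field
    z<2^b : z ℕ.< 2 ^ b

  Nonempty : Set
  Nonempty = 1 ℕ.≤ z

  level : Fin N → ℤ
  level i = lo ℤ.+ + toℕ i

  SS : Fin N → ℕ
  SS i = ℕ.sum (significands i)

  W : Fin N → ℚ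
  W i = (+ SS i / 1) ℚ.* exp2 (level i)

  ΣW : ℚ
  ΣW = sumℚ W

  -- W i * 2^G is nonnegative, so ∣_∣ only turns its floor into a natural number.
  A : ℤ → Fin N → ℕ
  A G i = if does (SS i ℕ.≟ 0) then 0 else ∣ floor (W i ℚ.* exp2 G) ∣ ℕ.+ 1

  ΣA : ℤ → ℕ
  ΣA G = sumℕ (A G)

  SS-pos : ∀ i → 1 ℕ.≤ length (significands i) → ℕ.NonZero (SS i)
  SS-pos i 1≤len with significands i | normalized i
  ... | x ∷ xs | (2^b-1≤x , _) All.∷ _ =
    ℕ.>-nonZero (ℕ.≤-trans (ℕ.m^n>0 2 (b ∸ 1)) (ℕ.≤-trans 2^b-1≤x (ℕ.m≤m+n x _)))

  ΣW≢0 : Nonempty → ℚ.NonZero ΣW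
  ΣW≢0 nonempty with i , 1≤len ← sumℕ-pos (λ i → length (significands i)) nonempty =
    ℚ.>-nonZero (sumℚ-pos W (λ j → scaled-nonNeg (SS j) (level j)) i
                  (scaled-pos (SS i) (level i) {{SS-pos i 1≤len}}))

-- The sampler as a Markov chain in which every step from `outer` or `refine`
-- consumes exactly one fresh random draw.
module Sampler {b : ℕ} (c : Config b) (G : ℤ) where
  open Config c

  data State : Set where
    outer    : State                     -- about to draw x in a new outer iteration
    refine   : Fin N → (m : ℕ) → State   -- about to draw the m-th r at this level
    returned : Fin N → State
    stuck    : State                     -- the scan ran past the lowest level

  scanOrder : List (Fin N)
  scanOrder = dropWhile (λ i → SS i ℕ.≟ 0) (reverse (allFin N))

  scan : List (Fin N) → ℕ → State
  scan []       x = stuck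
  scan (i ∷ is) x =
    tricho x (A G i) (returned i) (refine i 1) (scan is (x ∸ A G i))

  exponent : Fin N → ℕ → ℤ
  exponent i m = level i ℤ.+ G ℤ.+ + (m ℕ.* b)

  digit : Fin N → ℕ → ℕ
  digit i m = (floor ((+ SS i / 1) ℚ.* exp2 (exponent i m)) %ℕ (2 ^ b)) {{2^n≢0 b}}

  compareDigit : Fin N → ℕ → ℕ → State
  compareDigit i m r =
    tricho r (digit i m)
      (returned i)
      (if does (ℤ.0ℤ ℤ.≤? exponent i m) then outer else refine i (suc m))
      outer

  step : State → Dist State
  step outer        = uniform (ΣA G) >>= λ k → dirac (scan scanOrder (suc k))
  step (refine i m) = uniform (2 ^ b) >>= λ r → dirac (compareDigit i m r)
  step (returned i) = dirac (returned i)
  step stuck        = dirac stuck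

  run : ℕ → Dist State
  run zero    = dirac outer
  run (suc n) = run n >>= step

  Returned : Fin N → State → Set
  Returned i s = s ≡ returned i

  Terminated : State → Set
  Terminated s = ∃[ i ] Returned i s

  returned? : ∀ i → Decidable (Returned i)
  returned? i outer        = no λ ()
  returned? i (refine _ _) = no λ ()
  returned? i stuck        = no λ ()
  returned? i (returned j) with j Fin.≟ i
  ... | yes refl = yes refl
  ... | no  j≢i  = no λ { refl → j≢i refl }

  terminated? : Decidable Terminated
  terminated? outer        = no λ ()
  terminated? (refine _ _) = no λ ()
  terminated? stuck        = no λ ()
  terminated? (returned i) = yes (i , refl)

  -- `returned` states are absorbing, so the events "the chain is in P after n
  -- steps" increase with n when P consists of such states, and the probability
  -- of their union, i.e. of ever reaching P, is the limit of their
  -- probabilities.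
  EventuallyWithProbability : {P : State → Set} → Decidable P → ℚ → Set
  EventuallyWithProbability P? p = (λ n → Pr P? (run n)) ⟶ p

  TerminatesWithProbability : ℚ → Set
  TerminatesWithProbability = EventuallyWithProbability terminated?

  ReturnsWithProbability : Fin N → ℚ → Set
  ReturnsWithProbability i = EventuallyWithProbability (returned? i)

{-# OPTIONS --safe #-}

-- Let q_{i,m} be the fractional part of W_i 2^{G+(m-1)b}: this is the
-- probability that a refinement at level i about to draw its m-th digit
-- accepts, and splitting off the leading base-2^b digit gives the recursion
-- for it that the digit comparison realises. Consequently, for rewards u_i
-- with Σ W_i u_i = a ΣW, the function with value a at `outer`, u_i at
-- `returned i` and q_{i,m} u_i + (1 - q_{i,m}) a at `refine i m` is harmonic
-- for the chain. A potential that drops in expectation by at least 1 per step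
-- while the chain is still running bounds n times the probability of running
-- after n steps. So the probability of having returned differs by O(1/n) from
-- the constant expectation a of the harmonic function.

module Submission where

open import Defs
open import Level using (0ℓ)
open import Algebra.Bundles using (CommutativeMonoid; CommutativeRing)
import Algebra.Properties.Monoid.Sum as MonoidSum
open import Data.Bool using (true; false; if_then_else_)
open import Data.Nat as ℕ using (ℕ; zero; suc; _^_; _∸_)
import Data.Nat.Properties as ℕ
open import Data.Integer as ℤ using (ℤ; +_; -[1+_])
open import Data.Integer.DivMod as ℤ using (_%ℕ_; _/ℕ_)
import Data.Integer.Properties as ℤ
import Data.Rational.Unnormalised as ℚᵘ
import Data.Rational.Unnormalised.Properties as ℚᵘ
open import Data.Fin as Fin using (Fin; toℕ)
open import Data.List as List using (List; []; _∷_; _++_; reverse; dropWhile; allFin)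
open import Data.List.Properties using (unfold-reverse)
open import Data.List.Relation.Unary.All as All using (All; []; _∷_)
import Data.List.Relation.Unary.All.Properties as All
open import Data.Product using (_×_; _,_; ∃-syntax)
open import Data.Rational as ℚ
  using (ℚ; mkℚ; 0ℚ; 1ℚ; _/_; floor; _+_; _*_; _-_; -_; _≤_; _<_; _÷_; 1/_; ∣_∣; toℚᵘ;
         *≤*; *<*; Positive; nonNegative; positive)
open import Data.Rational.Properties
open import Data.Rational.Solver using (module +-*-Solver)
open import Data.Sum using (_⊎_; inj₁; inj₂)
open import Function using (_∘_; id; case_of_)
open import Relation.Binary using (tri<; tri≈; tri>)
open import Relation.Binary.PropositionalEquality
open import Relation.Nullary using (yes; no; does; contradiction)
open import Relation.Nullary.Decidable using (dec-true; dec-false)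
open import Relation.Unary using (Decidable)

open MonoidSum ℕ.+-0-monoid using () renaming (sum to ℕ-sum)
open import Algebra.Properties.Semiring.Sum (CommutativeRing.semiring +-*-commutativeRing)
  using (sum; sum-cong-≗; sum-replicate-zero; *-distribʳ-sum; ∑-distrib-+)

private variable X Y : Set

-- Integers, floors and powers of two in ℚ

0≤1 : 0ℚ ≤ 1ℚ
0≤1 = *≤* (ℤ.+≤+ ℕ.z≤n)

pos⇒0≤1/ : ∀ p .{{_ : Positive p}} .{{_ : ℚ.NonZero p}} → 0ℚ ≤ 1/ p
pos⇒0≤1/ (mkℚ ℤ.+[1+ _ ] _ _) = *≤* (ℤ.+≤+ ℕ.z≤n)

*-÷-cancel : ∀ p q .{{_ : ℚ.NonZero q}} → q * (p ÷ q) ≡ p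
*-÷-cancel p q = begin
  q * (p * 1/ q)  ≡⟨ *-comm q _ ⟩
  p * 1/ q * q    ≡⟨ *-assoc p (1/ q) q ⟩
  p * (1/ q * q)  ≡⟨ cong (p *_) (*-inverseˡ q) ⟩
  p * 1ℚ          ≡⟨ *-identityʳ p ⟩
  p               ∎
  where open ≡-Reasoning

*-nonNeg : ∀ {p q} → 0ℚ ≤ p → 0ℚ ≤ q → 0ℚ ≤ p * q
*-nonNeg {p} {q} 0≤p 0≤q =
  nonNegative⁻¹ _ {{nonNeg*nonNeg⇒nonNeg p {{nonNegative 0≤p}} q {{nonNegative 0≤q}}}}

*-monoˡ : ∀ {p q r} → 0ℚ ≤ r → p ≤ q → r * p ≤ r * q
*-monoˡ {r = r} 0≤r = *-monoˡ-≤-nonNeg r {{nonNegative 0≤r}}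

p-q≥0 : ∀ {p q} → q ≤ p → 0ℚ ≤ p - q
p-q≥0 {p} {q} q≤p = subst (_≤ p - q) (+-inverseʳ q) (+-monoˡ-≤ (- q) q≤p)

p+q-q≡p : ∀ p q → p + q - q ≡ p
p+q-q≡p = solve 2 (λ p q → p :+ q :- q := p) refl
  where open +-*-Solver

p-q+q≡p : ∀ p q → p - q + q ≡ p
p-q+q≡p = solve 2 (λ p q → p :- q :+ q := p) refl
  where open +-*-Solver

∣-∣-≤ : ∀ {p a d} → p ≤ a → a ≤ p + d → ∣ p - a ∣ ≤ d
∣-∣-≤ {p} {a} {d} p≤a a≤p+d = begin
  ∣ p - a ∣      ≡⟨ cong ∣_∣ (solve 2 (λ p a → p :- a := :- (a :- p)) refl p a) ⟩
  ∣ - (a - p) ∣  ≡⟨ ∣-p∣≡∣p∣ (a - p) ⟩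
  ∣ a - p ∣      ≡⟨ 0≤p⇒∣p∣≡p (p-q≥0 p≤a) ⟩
  a - p          ≤⟨ +-monoˡ-≤ (- p) a≤p+d ⟩
  p + d - p      ≡⟨ solve 2 (λ p d → p :+ d :- p := d) refl p d ⟩
  d              ∎
  where
    open ≤-Reasoning
    open +-*-Solver

i≤+∣i∣ : ∀ i → i ℤ.≤ + ℤ.∣ i ∣
i≤+∣i∣ (+ n)    = ℤ.≤-refl
i≤+∣i∣ -[1+ n ] = ℤ.-≤+

-∣i∣≤i : ∀ i → ℤ.- (+ ℤ.∣ i ∣) ℤ.≤ i
-∣i∣≤i (+ n)    = ℤ.neg-≤-pos {n} {n}
-∣i∣≤i -[1+ n ] = ℤ.≤-refl

fromℤ : ℤ → ℚ
fromℤ i = i / 1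

fromℕ : ℕ → ℚ
fromℕ n = fromℤ (+ n)

toℚᵘ-fromℤ : ∀ i → toℚᵘ (fromℤ i) ℚᵘ.≃ ℚᵘ.mkℚᵘ i 0
toℚᵘ-fromℤ i = toℚᵘ-fromℚᵘ (ℚᵘ.mkℚᵘ i 0)

fromℤ-homo-+ : ∀ i j → fromℤ (i ℤ.+ j) ≡ fromℤ i + fromℤ j
fromℤ-homo-+ i j = toℚᵘ-injective (begin-equality
  toℚᵘ (fromℤ (i ℤ.+ j))                    ≃⟨ toℚᵘ-fromℤ (i ℤ.+ j) ⟩
  ℚᵘ.mkℚᵘ (i ℤ.+ j) 0                       ≃⟨ ℚᵘ.*≡* (cong (ℤ._* + 1) (cong₂ ℤ._+_ (sym (ℤ.*-identityʳ i)) (sym (ℤ.*-identityʳ j)))) ⟩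
  ℚᵘ.mkℚᵘ i 0 ℚᵘ.+ ℚᵘ.mkℚᵘ j 0              ≃⟨ ℚᵘ.+-cong (toℚᵘ-fromℤ i) (toℚᵘ-fromℤ j) ⟨
  toℚᵘ (fromℤ i) ℚᵘ.+ toℚᵘ (fromℤ j)        ≃⟨ toℚᵘ-homo-+ (fromℤ i) (fromℤ j) ⟨
  toℚᵘ (fromℤ i + fromℤ j)                  ∎)
  where open ℚᵘ.≤-Reasoning

fromℤ-homo-* : ∀ i j → fromℤ (i ℤ.* j) ≡ fromℤ i * fromℤ j
fromℤ-homo-* i j = toℚᵘ-injective (begin-equality
  toℚᵘ (fromℤ (i ℤ.* j))                    ≃⟨ toℚᵘ-fromℤ (i ℤ.* j) ⟩
  ℚᵘ.mkℚᵘ i 0 ℚᵘ.* ℚᵘ.mkℚᵘ j 0              ≃⟨ ℚᵘ.*-cong (toℚᵘ-fromℤ i) (toℚᵘ-fromℤ j) ⟨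
  toℚᵘ (fromℤ i) ℚᵘ.* toℚᵘ (fromℤ j)        ≃⟨ toℚᵘ-homo-* (fromℤ i) (fromℤ j) ⟨
  toℚᵘ (fromℤ i * fromℤ j)                  ∎)
  where open ℚᵘ.≤-Reasoning

fromℤ-mono-≤ : ∀ {i j} → i ℤ.≤ j → fromℤ i ≤ fromℤ j
fromℤ-mono-≤ {i} {j} i≤j = toℚᵘ-cancel-≤ (begin
  toℚᵘ (fromℤ i) ≃⟨ toℚᵘ-fromℤ i ⟩
  ℚᵘ.mkℚᵘ i 0    ≤⟨ ℚᵘ.*≤* (ℤ.*-monoʳ-≤-nonNeg (+ 1) i≤j) ⟩
  ℚᵘ.mkℚᵘ j 0    ≃⟨ toℚᵘ-fromℤ j ⟨
  toℚᵘ (fromℤ j) ∎)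
  where open ℚᵘ.≤-Reasoning

fromℤ-cancel-< : ∀ {i j} → fromℤ i < fromℤ j → i ℤ.< j
fromℤ-cancel-< i<j = ℤ.≰⇒> λ j≤i → <-irrefl refl (<-≤-trans i<j (fromℤ-mono-≤ j≤i))

fromℕ-mono-≤ : ∀ {m n} → m ℕ.≤ n → fromℕ m ≤ fromℕ n
fromℕ-mono-≤ m≤n = fromℤ-mono-≤ (ℤ.+≤+ m≤n)

fromℕ-nonNeg : ∀ n → 0ℚ ≤ fromℕ n
fromℕ-nonNeg n = fromℤ-mono-≤ {+ 0} {+ n} (ℤ.+≤+ ℕ.z≤n)

fromℕ-homo-+ : ∀ m n → fromℕ (m ℕ.+ n) ≡ fromℕ m + fromℕ n
fromℕ-homo-+ m n = fromℤ-homo-+ (+ m) (+ n)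

fromℕ-homo-* : ∀ m n → fromℕ (m ℕ.* n) ≡ fromℕ m * fromℕ n
fromℕ-homo-* m n = trans (cong fromℤ (ℤ.pos-* m n)) (fromℤ-homo-* (+ m) (+ n))

fromℕ-suc : ∀ n → fromℕ (suc n) ≡ 1ℚ + fromℕ n
fromℕ-suc n = fromℕ-homo-+ 1 n

fromℕ*1/ : ∀ n .{{_ : ℕ.NonZero n}} → fromℕ n * (+ 1 / n) ≡ 1ℚ
fromℕ*1/ n@(suc n-1) = toℚᵘ-injective (begin-equality
  toℚᵘ (fromℕ n * (+ 1 / n))            ≃⟨ toℚᵘ-homo-* (fromℕ n) (+ 1 / n) ⟩
  toℚᵘ (fromℕ n) ℚᵘ.* toℚᵘ (+ 1 / n)    ≃⟨ ℚᵘ.*-cong (toℚᵘ-fromℤ (+ n)) (toℚᵘ-fromℚᵘ (ℚᵘ.mkℚᵘ (+ 1) n-1)) ⟩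
  ℚᵘ.mkℚᵘ (+ n) 0 ℚᵘ.* ℚᵘ.mkℚᵘ (+ 1) n-1 ≃⟨ ℚᵘ.*≡* (trans (ℤ.*-comm (+ n ℤ.* + 1) (+ 1)) (cong (+ 1 ℤ.*_) (ℤ.*-comm (+ n) (+ 1)))) ⟩
  toℚᵘ 1ℚ                               ∎)
  where open ℚᵘ.≤-Reasoning

fromℕ-*-cancelˡ : ∀ n .{{_ : ℕ.NonZero n}} {p q} → fromℕ n * p ≡ fromℕ n * q → p ≡ q
fromℕ-*-cancelˡ n {p} {q} np≡nq = trans (insert p) (trans (cong (+ 1 / n *_) np≡nq) (sym (insert q)))
  where
    open ≡-Reasoning
    insert : ∀ p → p ≡ + 1 / n * (fromℕ n * p)
    insert p = begin
      p                          ≡⟨ *-identityˡ p ⟨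
      1ℚ * p                     ≡⟨ cong (_* p) (trans (*-comm (+ 1 / n) (fromℕ n)) (fromℕ*1/ n)) ⟨
      + 1 / n * fromℕ n * p      ≡⟨ *-assoc (+ 1 / n) (fromℕ n) p ⟩
      + 1 / n * (fromℕ n * p)    ∎

1/-nonNeg : ∀ n .{{_ : ℕ.NonZero n}} → 0ℚ ≤ + 1 / n
1/-nonNeg n = nonNegative⁻¹ _ {{normalize-nonNeg 1 n}}

floor-≤ : ∀ p → fromℤ (floor p) ≤ p
floor-≤ p@(mkℚ n d-1 _) = toℚᵘ-cancel-≤ (begin
  toℚᵘ (fromℤ (floor p))  ≃⟨ toℚᵘ-fromℤ (floor p) ⟩
  ℚᵘ.mkℚᵘ (floor p) 0     ≤⟨ ℚᵘ.*≤* (ℤ.≤-trans (ℤ.[n/d]*d≤n n (+ suc d-1)) (ℤ.≤-reflexive (sym (ℤ.*-identityʳ n)))) ⟩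
  toℚᵘ p                  ∎)
  where open ℚᵘ.≤-Reasoning

<-suc-floor : ∀ p → p < fromℤ (ℤ.suc (floor p))
<-suc-floor p@(mkℚ n d-1 _) = toℚᵘ-cancel-< (begin-strict
  toℚᵘ p                          <⟨ ℚᵘ.*<* (ℤ.≤-<-trans (ℤ.≤-reflexive (ℤ.*-identityʳ n)) n<) ⟩
  ℚᵘ.mkℚᵘ (ℤ.suc (floor p)) 0     ≃⟨ toℚᵘ-fromℤ (ℤ.suc (floor p)) ⟨
  toℚᵘ (fromℤ (ℤ.suc (floor p)))  ∎)
  where
    open ℚᵘ.≤-Reasoning
    n< : n ℤ.< ℤ.suc (floor p) ℤ.* + suc d-1
    n< = subst (λ q → n ℤ.< ℤ.suc q ℤ.* + suc d-1) (sym (ℤ.div-pos-is-/ℕ n (suc d-1))) (ℤ.n<s[n/ℕd]*d n (suc d-1))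

floor-unique : ∀ {p} k → fromℤ k ≤ p → p < fromℤ (ℤ.suc k) → floor p ≡ k
floor-unique {p} k k≤p p<k+1 = ℤ.≤-antisym
  (below {floor p} {k} (≤-<-trans (floor-≤ p) p<k+1))
  (below {k} {floor p} (≤-<-trans k≤p (<-suc-floor p)))
  where
    below : ∀ {i j} → fromℤ i < fromℤ (ℤ.suc j) → i ℤ.≤ j
    below {i} {j} lt = ℤ.≤-trans (ℤ.i<j⇒i≤pred[j] (fromℤ-cancel-< {i} {ℤ.suc j} lt)) (ℤ.≤-reflexive (ℤ.pred-suc j))

floor-nonNeg : ∀ {p} → 0ℚ ≤ p → + ℤ.∣ floor p ∣ ≡ floor p
floor-nonNeg {p} 0≤p = ℤ.0≤i⇒+∣i∣≡i (subst (ℤ.0ℤ ℤ.≤_) (ℤ.pred-suc (floor p))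
  (ℤ.i<j⇒i≤pred[j] (fromℤ-cancel-< {ℤ.0ℤ} {ℤ.suc (floor p)} (≤-<-trans 0≤p (<-suc-floor p)))))

frac : ℚ → ℚ
frac p = p - fromℤ (floor p)

floor+frac : ∀ p → fromℤ (floor p) + frac p ≡ p
floor+frac p = solve 2 (λ n x → n :+ (x :- n) := x) refl (fromℤ (floor p)) p
  where open +-*-Solver

frac-nonNeg : ∀ p → 0ℚ ≤ frac p
frac-nonNeg p = p-q≥0 (floor-≤ p)

frac-≤1 : ∀ p → frac p ≤ 1ℚ
frac-≤1 p = begin
  p - n             ≤⟨ +-monoˡ-≤ (- n) (<⇒≤ (<-suc-floor p)) ⟩
  fromℤ (ℤ.suc (floor p)) - n      ≡⟨ cong (_- n) (fromℤ-homo-+ (+ 1) (floor p)) ⟩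
  (1ℚ + n) - n  ≡⟨ solve 2 (λ o n → (o :+ n) :- n := o) refl 1ℚ n ⟩
  1ℚ ∎
  where
    open ≤-Reasoning
    open +-*-Solver
    n = fromℤ (floor p)

frac-fromℤ : ∀ i → frac (fromℤ i) ≡ 0ℚ
frac-fromℤ i = trans (cong (λ k → fromℤ i - fromℤ k) (floor-unique i ≤-refl i<suci)) (+-inverseʳ (fromℤ i))
  where
  i<suci : fromℤ i < fromℤ (ℤ.suc i)
  i<suci = subst₂ _<_ (+-identityˡ _) (sym (fromℤ-homo-+ (+ 1) i)) (+-monoˡ-< (fromℤ i) {0ℚ} {1ℚ} (*<* (ℤ.+<+ (ℕ.s≤s ℕ.z≤n))))

-- Write `floor y` as t + d B with remainder t. Then `floor (y / B)` is d, so multiplying the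
-- fractional part of y / B by B leaves t + `frac y`. This is one step of the base-`B` expansion,
-- the step which a comparison of `r` with a digit simulates.
leading-digit : ∀ B .{{_ : ℕ.NonZero B}} y →
  fromℕ (floor y %ℕ B) + frac y ≡ fromℕ B * frac (y * (+ 1 / B))
leading-digit B y = begin
  t + (y - fromℤ (floor y))    ≡⟨ cong (λ z → t + (y - z)) floor-y ⟩
  t + (y - (t + fromℤ d * β))  ≡⟨ solve 4 (λ t y d β → t :+ (y :- (t :+ d :* β)) := y :- d :* β) refl t y (fromℤ d) β ⟩
  y - fromℤ d * β              ≡⟨ cong (_- fromℤ d * β) (sym yδβ) ⟩
  y * δ * β - fromℤ d * β      ≡⟨ solve 3 (λ z d β → z :* β :- d :* β := β :* (z :- d)) refl (y * δ) (fromℤ d) β ⟩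
  β * (y * δ - fromℤ d)        ≡⟨ cong (λ k → β * (y * δ - fromℤ k)) (sym floor-yδ) ⟩
  β * frac (y * δ)             ∎
  where
    open ≡-Reasoning
    open +-*-Solver
    β = fromℕ B
    δ = + 1 / B
    t = fromℕ (floor y %ℕ B)
    d = floor y /ℕ B

    floor-y : fromℤ (floor y) ≡ t + fromℤ d * β
    floor-y = trans (cong fromℤ {floor y} (ℤ.a≡a%ℕn+[a/ℕn]*n (floor y) B))
                (trans (fromℤ-homo-+ (+ (floor y %ℕ B)) (d ℤ.* + B)) (cong (λ z → t + z) (fromℤ-homo-* d (+ B))))

    βδ : β * δ ≡ 1ℚ
    βδ = fromℕ*1/ B

    cancel : ∀ z → z * β * δ ≡ z
    cancel z = trans (*-assoc z β δ) (trans (cong (z *_) βδ) (*-identityʳ z))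

    yδβ : y * δ * β ≡ y
    yδβ = trans (solve 3 (λ y δ β → y :* δ :* β := y :* β :* δ) refl y δ β) (cancel y)

    instance
      β⁺ : Positive β
      β⁺ = normalize-pos B 1

    -- The quotient of `floor y` is also the floor of y / B: d B ≤ `floor y` ≤ y on one side, y <
    -- `floor y` + 1 ≤ (d + 1) B on the other.
    floor-yδ : floor (y * δ) ≡ d
    floor-yδ = floor-unique {y * δ} d
      (*-cancelʳ-≤-pos β (subst₂ _≤_ (fromℤ-homo-* d (+ B)) (sym yδβ)
        (≤-trans (fromℤ-mono-≤ (ℤ.[n/ℕd]*d≤n (floor y) B)) (floor-≤ y))))
      (*-cancelʳ-<-nonNeg β {{pos⇒nonNeg β}} (subst₂ _<_ (sym yδβ) (fromℤ-homo-* (ℤ.suc d) (+ B))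
        (<-≤-trans (<-suc-floor y) (fromℤ-mono-≤ (ℤ.i<j⇒suc[i]≤j (ℤ.n<s[n/ℕd]*d (floor y) B))))))

archimedean : ∀ C {ε} → 0ℚ < ε → ∃[ n ] C < fromℕ n * ε
-- The witness exceeds C / ε; passing from `k` to its absolute value yields a natural number and can
-- only enlarge the bound.
archimedean C {ε} 0<ε = suc ℤ.∣ k ∣ , (begin-strict
  C                         ≡⟨ C/ε*ε ⟨
  C ÷ ε * ε                 <⟨ *-monoˡ-<-pos ε (<-suc-floor (C ÷ ε)) ⟩
  fromℤ (ℤ.suc k) * ε       ≤⟨ *-monoʳ-≤-nonNeg ε {{pos⇒nonNeg ε}} (fromℤ-mono-≤ (ℤ.+-monoʳ-≤ (+ 1) (i≤+∣i∣ k))) ⟩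
  fromℕ (suc ℤ.∣ k ∣) * ε   ∎)
  where
    open ≤-Reasoning
    instance
      ε⁺ : Positive ε
      ε⁺ = positive 0<ε
      ε≢0 : ℚ.NonZero ε
      ε≢0 = pos⇒nonZero ε
    k = floor (C ÷ ε)
    C/ε*ε : C ÷ ε * ε ≡ C
    C/ε*ε = trans (*-comm (C ÷ ε) ε) (*-÷-cancel C ε)

exp2-suc : ∀ k → exp2 (ℤ.suc k) ≡ fromℕ 2 * exp2 k
exp2-suc (+ n)          = fromℕ-homo-* 2 (2 ^ n)
exp2-suc -[1+ zero ]    = refl
exp2-suc -[1+ suc n ]   = begin
  δ                       ≡⟨ *-identityʳ δ ⟨
  δ * 1ℚ                  ≡⟨ cong (δ *_) (fromℕ*1/ (2 ^ suc (suc n)) {{2^n≢0 (suc (suc n))}}) ⟨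
  δ * (fromℕ (2 ^ suc (suc n)) * δ′)
                          ≡⟨ cong (λ z → δ * (z * δ′)) (fromℕ-homo-* 2 (2 ^ suc n)) ⟩
  δ * (fromℕ 2 * β * δ′)  ≡⟨ solve 4 (λ t β δ δ′ → δ :* (t :* β :* δ′) := β :* δ :* (t :* δ′)) refl (fromℕ 2) β δ δ′ ⟩
  β * δ * (fromℕ 2 * δ′)  ≡⟨ cong (_* (fromℕ 2 * δ′)) (fromℕ*1/ (2 ^ suc n) {{2^n≢0 (suc n)}}) ⟩
  1ℚ * (fromℕ 2 * δ′)     ≡⟨ *-identityˡ _ ⟩
  fromℕ 2 * δ′            ∎
  where
    open ≡-Reasoning
    open +-*-Solver
    β δ δ′ : ℚ
    β = fromℕ (2 ^ suc n)
    δ = exp2 -[1+ n ]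
    δ′ = exp2 -[1+ suc n ]

exp2-+ℕ : ∀ k n → exp2 (k ℤ.+ + n) ≡ exp2 k * fromℕ (2 ^ n)
exp2-+ℕ k zero    = trans (cong exp2 (ℤ.+-identityʳ k)) (sym (*-identityʳ _))
exp2-+ℕ k (suc n) = begin
  exp2 (k ℤ.+ + suc n)              ≡⟨ cong exp2 (trans (cong (λ z → k ℤ.+ z) (ℤ.pos-+ 1 n)) (trans (sym (ℤ.+-assoc k (+ 1) (+ n))) (trans (cong (ℤ._+ + n) (ℤ.+-comm k (+ 1))) (ℤ.+-assoc (+ 1) k (+ n))))) ⟩
  exp2 (ℤ.suc (k ℤ.+ + n))          ≡⟨ exp2-suc (k ℤ.+ + n) ⟩
  fromℕ 2 * exp2 (k ℤ.+ + n)        ≡⟨ cong (fromℕ 2 *_) (exp2-+ℕ k n) ⟩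
  fromℕ 2 * (exp2 k * fromℕ (2 ^ n)) ≡⟨ solve 3 (λ t e b → t :* (e :* b) := e :* (t :* b)) refl (fromℕ 2) (exp2 k) (fromℕ (2 ^ n)) ⟩
  exp2 k * (fromℕ 2 * fromℕ (2 ^ n)) ≡⟨ cong (exp2 k *_) (fromℕ-homo-* 2 (2 ^ n)) ⟨
  exp2 k * fromℕ (2 ^ suc n)        ∎
  where
    open ≡-Reasoning
    open +-*-Solver

exp2-+ : ∀ k l → exp2 (k ℤ.+ l) ≡ exp2 k * exp2 l
exp2-+ k (+ n)    = exp2-+ℕ k n
-- Here k is the sum k + l raised by `suc n`, which reduces a negative summand to the case of a
-- natural one.
exp2-+ k -[1+ n ] = sym (begin
  exp2 k * δ                            ≡⟨ cong (λ z → exp2 z * δ) k≡ ⟩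
  exp2 (k ℤ.+ -[1+ n ] ℤ.+ + suc n) * δ ≡⟨ cong (_* δ) (exp2-+ℕ (k ℤ.+ -[1+ n ]) (suc n)) ⟩
  exp2 (k ℤ.+ -[1+ n ]) * fromℕ (2 ^ suc n) * δ ≡⟨ *-assoc (exp2 (k ℤ.+ -[1+ n ])) _ δ ⟩
  exp2 (k ℤ.+ -[1+ n ]) * (fromℕ (2 ^ suc n) * δ) ≡⟨ cong (exp2 (k ℤ.+ -[1+ n ]) *_) (fromℕ*1/ (2 ^ suc n) {{2^n≢0 (suc n)}}) ⟩
  exp2 (k ℤ.+ -[1+ n ]) * 1ℚ            ≡⟨ *-identityʳ _ ⟩
  exp2 (k ℤ.+ -[1+ n ])                 ∎)
  where
    open ≡-Reasoning
    δ = exp2 -[1+ n ]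
    k≡ : k ≡ k ℤ.+ -[1+ n ] ℤ.+ + suc n
    k≡ = sym (trans (ℤ.+-assoc k -[1+ n ] (+ suc n)) (trans (cong (λ z → k ℤ.+ z) (ℤ.+-inverseˡ (+ suc n))) (ℤ.+-identityʳ k)))

exp2-nonNeg-integer : ∀ {k} → + 0 ℤ.≤ k → exp2 k ≡ fromℕ (2 ^ ℤ.∣ k ∣)
exp2-nonNeg-integer {+ n} _ = refl

-- Finite sums

sum-mono : ∀ {n} {f g : Fin n → ℚ} → (∀ i → f i ≤ g i) → sum f ≤ sum g
sum-mono {zero}  f≤g = ≤-refl
sum-mono {suc n} f≤g = +-mono-≤ (f≤g Fin.zero) (sum-mono (λ i → f≤g (Fin.suc i)))

sum-single : ∀ {n} (f : Fin n → ℚ) i → (∀ j → j ≢ i → f j ≡ 0ℚ) → sum f ≡ f i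
sum-single {suc n} f Fin.zero    f≡0 = trans
  (cong (λ z → f Fin.zero + z) (trans (sum-cong-≗ (λ j → f≡0 (Fin.suc j) λ ())) (sum-replicate-zero n)))
  (+-identityʳ _)
sum-single {suc n} f (Fin.suc i) f≡0 = trans
  (cong₂ _+_ (f≡0 Fin.zero λ ())
    (sum-single (λ j → f (Fin.suc j)) i λ j j≢i → f≡0 (Fin.suc j) λ { refl → j≢i refl }))
  (+-identityˡ _)

sum-fromℕ : ∀ {n} (f : Fin n → ℕ) → sum (λ i → fromℕ (f i)) ≡ fromℕ (ℕ-sum f)
sum-fromℕ {zero}  f = refl
sum-fromℕ {suc n} f = trans (cong (λ z → fromℕ (f Fin.zero) + z) (sum-fromℕ (λ i → f (Fin.suc i)))) (sym (fromℕ-homo-+ (f Fin.zero) _))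

-- The summand lives on ℕ instead of `Fin n`, so that a range can be split or its length rewritten
-- along an equation without transporting indices.
rangeSum : ℕ → (ℕ → ℚ) → ℚ
rangeSum n f = sum {n} (λ i → f (toℕ i))

rangeSum-cong : ∀ n {f g : ℕ → ℚ} → (∀ {k} → k ℕ.< n → f k ≡ g k) → rangeSum n f ≡ rangeSum n g
rangeSum-cong zero    f≗g = refl
rangeSum-cong (suc n) f≗g = cong₂ _+_ (f≗g (ℕ.s≤s ℕ.z≤n)) (rangeSum-cong n λ k<n → f≗g (ℕ.s≤s k<n))

rangeSum-const : ∀ n p → rangeSum n (λ _ → p) ≡ fromℕ n * p
rangeSum-const zero    p = sym (*-zeroˡ p)
rangeSum-const (suc n) p = begin
  p + rangeSum n (λ _ → p)  ≡⟨ cong (λ z → p + z) (rangeSum-const n p) ⟩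
  p + fromℕ n * p           ≡⟨ cong (_+ fromℕ n * p) (*-identityˡ p) ⟨
  1ℚ * p + fromℕ n * p      ≡⟨ *-distribʳ-+ p 1ℚ (fromℕ n) ⟨
  (1ℚ + fromℕ n) * p        ≡⟨ cong (_* p) (fromℕ-suc n) ⟨
  fromℕ (suc n) * p         ∎
  where open ≡-Reasoning

rangeSum-+ : ∀ m n f → rangeSum (m ℕ.+ n) f ≡ rangeSum m f + rangeSum n (λ k → f (m ℕ.+ k))
rangeSum-+ zero    n f = sym (+-identityˡ _)
rangeSum-+ (suc m) n f = trans (cong (λ z → f 0 + z) (rangeSum-+ m n (f ∘ suc))) (sym (+-assoc (f 0) _ _))

-- Three-way comparisons and sums over their outcomes

tricho-< : ∀ {x y} {l e g : X} → x ℕ.< y → tricho x y l e g ≡ l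
tricho-< {x = x} {y} x<y with ℕ.<-cmp x y
... | tri< _ _ _   = refl
... | tri≈ x≮y _ _ = contradiction x<y x≮y
... | tri> x≮y _ _ = contradiction x<y x≮y

tricho-≡ : ∀ {x y} {l e g : X} → x ≡ y → tricho x y l e g ≡ e
tricho-≡ {x = x} {y} x≡y with ℕ.<-cmp x y
... | tri< _ x≢y _ = contradiction x≡y x≢y
... | tri≈ _ _ _   = refl
... | tri> _ x≢y _ = contradiction x≡y x≢y

tricho-> : ∀ {x y} {l e g : X} → y ℕ.< x → tricho x y l e g ≡ g
tricho-> {x = x} {y} y<x with ℕ.<-cmp x y
... | tri< _ _ x≯y = contradiction y<x x≯y
... | tri≈ _ _ x≯y = contradiction y<x x≯y
... | tri> _ _ _   = refl

tricho-elim : ∀ (P : X → Set) x y {l e g} → P l → P e → P g → P (tricho x y l e g)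
tricho-elim P x y pl pe pg with ℕ.<-cmp x y
... | tri< _ _ _ = pl
... | tri≈ _ _ _ = pe
... | tri> _ _ _ = pg

-- Both random draws of the sampler are compared with a threshold: t outcomes lie below it, one is a
-- tie, n lie above. The upper part stays a sum, because the outer draw moves on to the next level
-- there while a digit draw restarts.
rangeSum-tricho : ∀ {t n} (f : ℕ → ℚ) {l e} →
  (∀ {k} → k ℕ.< t → f k ≡ l) → f t ≡ e →
  rangeSum (t ℕ.+ suc n) f ≡ fromℕ t * l + e + rangeSum n (λ k → f (t ℕ.+ suc k))
rangeSum-tricho {t} {n} f {l} {e} f< f≡ = begin
  rangeSum (t ℕ.+ suc n) f
    ≡⟨ rangeSum-+ t (suc n) f ⟩
  rangeSum t f + (f (t ℕ.+ 0) + rest)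
    ≡⟨ cong₂ (λ x y → x + (y + rest))
         (trans (rangeSum-cong t f<) (rangeSum-const t l))
         (trans (cong f (ℕ.+-identityʳ t)) f≡) ⟩
  fromℕ t * l + (e + rest)
    ≡⟨ +-assoc (fromℕ t * l) e rest ⟨
  fromℕ t * l + e + rest ∎
  where
    open ≡-Reasoning
    rest = rangeSum n (λ k → f (t ℕ.+ suc k))

-- The scan order is the reversed list of levels without its leading empty ones. Neither change
-- affects a sum whose terms vanish at empty levels. The monoid is arbitrary because this is applied
-- to the interval lengths in ℕ and to the expected rewards in ℚ.
module ListSum (M : CommutativeMonoid 0ℓ 0ℓ) where
  open CommutativeMonoid M renaming (Carrier to C; refl to ≈-refl; sym to ≈-sym; trans to ≈-trans; _∙_ to _⊕_)
  open MonoidSum monoid using () renaming (sum to sumᴹ)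

  listSum : (X → C) → List X → C
  listSum f = List.foldr (λ x s → f x ⊕ s) ε

  listSum-∷ʳ : ∀ (f : X → C) xs x → listSum f (xs List.∷ʳ x) ≈ f x ⊕ listSum f xs
  listSum-∷ʳ f []       x = ≈-refl
  listSum-∷ʳ f (y ∷ xs) x = ≈-trans (∙-congˡ (listSum-∷ʳ f xs x))
    (≈-trans (≈-sym (assoc _ _ _)) (≈-trans (∙-congʳ (comm _ _)) (assoc _ _ _)))

  listSum-reverse : ∀ (f : X → C) xs → listSum f (reverse xs) ≈ listSum f xs
  listSum-reverse f []       = ≈-refl
  listSum-reverse f (x ∷ xs) = ≈-trans (reflexive (cong (listSum f) (unfold-reverse x xs)))
    (≈-trans (listSum-∷ʳ f (reverse xs) x) (∙-congˡ (listSum-reverse f xs)))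

  listSum-dropWhile : ∀ {P : X → Set} (P? : Decidable P) (f : X → C) →
    (∀ {x} → P x → f x ≈ ε) → ∀ xs → listSum f (dropWhile P? xs) ≈ listSum f xs
  listSum-dropWhile P? f f≈ε []       = ≈-refl
  listSum-dropWhile P? f f≈ε (x ∷ xs) with P? x
  ... | yes px = ≈-trans (listSum-dropWhile P? f f≈ε xs)
                   (≈-trans (≈-sym (identityˡ _)) (∙-congʳ (≈-sym (f≈ε px))))
  ... | no  _  = ≈-refl

  listSum-tabulate : ∀ {n} (f : X → C) (g : Fin n → X) → listSum f (List.tabulate g) ≈ sumᴹ (λ i → f (g i))
  listSum-tabulate {n = zero}  f g = ≈-refl
  listSum-tabulate {n = suc n} f g = ∙-congˡ (listSum-tabulate f (λ i → g (Fin.suc i)))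

-- Expectations of finitely supported measures

NonNegative-Dist : Dist X → Set
NonNegative-Dist = All (λ (p , _) → 0ℚ ≤ p)

𝔼 : (X → ℚ) → Dist X → ℚ
𝔼 f []            = 0ℚ
𝔼 f ((p , x) ∷ d) = p * f x + 𝔼 f d

indicator : {P : X → Set} → Decidable P → X → ℚ
indicator P? x = if does (P? x) then 1ℚ else 0ℚ

Pr≡𝔼 : {P : X → Set} (P? : Decidable P) → ∀ d → Pr P? d ≡ 𝔼 (indicator P?) d
Pr≡𝔼 P? []            = refl
Pr≡𝔼 P? ((p , x) ∷ d) with does (P? x)
... | true  = cong₂ _+_ (sym (*-identityʳ p)) (Pr≡𝔼 P? d)
... | false = cong₂ _+_ (sym (*-zeroʳ p)) (Pr≡𝔼 P? d)

indicator-nonNeg : ∀ {P : X → Set} (P? : Decidable P) x → 0ℚ ≤ indicator P? x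
indicator-nonNeg P? x with does (P? x)
... | true  = 0≤1
... | false = ≤-refl

indicator-≤1 : ∀ {P : X → Set} (P? : Decidable P) x → indicator P? x ≤ 1ℚ
indicator-≤1 P? x with does (P? x)
... | true  = ≤-refl
... | false = 0≤1

𝔼-cong : ∀ {f g : X → ℚ} d → (∀ x → f x ≡ g x) → 𝔼 f d ≡ 𝔼 g d
𝔼-cong []            f≗g = refl
𝔼-cong ((p , x) ∷ d) f≗g = cong₂ _+_ (cong (p *_) (f≗g x)) (𝔼-cong d f≗g)

𝔼-mono : ∀ {f g : X → ℚ} {d} → NonNegative-Dist d → (∀ x → f x ≤ g x) → 𝔼 f d ≤ 𝔼 g d
𝔼-mono []         f≤g = ≤-refl
𝔼-mono (0≤p ∷ d≥0) f≤g = +-mono-≤ (*-monoˡ 0≤p (f≤g _)) (𝔼-mono d≥0 f≤g)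

𝔼-+ : ∀ (f g : X → ℚ) d → 𝔼 (λ x → f x + g x) d ≡ 𝔼 f d + 𝔼 g d
𝔼-+ f g []            = refl
𝔼-+ f g ((p , x) ∷ d) = trans (cong (λ z → p * (f x + g x) + z) (𝔼-+ f g d))
  (solve 5 (λ p a b c d → p :* (a :+ b) :+ (c :+ d) := (p :* a :+ c) :+ (p :* b :+ d)) refl p (f x) (g x) (𝔼 f d) (𝔼 g d))
  where open +-*-Solver

𝔼-zero : ∀ (d : Dist X) → 𝔼 (λ _ → 0ℚ) d ≡ 0ℚ
𝔼-zero []            = refl
𝔼-zero ((p , _) ∷ d) = cong₂ _+_ (*-zeroʳ p) (𝔼-zero d)

𝔼-nonNeg : ∀ {f : X → ℚ} {d} → NonNegative-Dist d → (∀ x → 0ℚ ≤ f x) → 0ℚ ≤ 𝔼 f d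
𝔼-nonNeg {f = f} {d} d≥0 0≤f = subst (_≤ 𝔼 f d) (𝔼-zero d) (𝔼-mono d≥0 0≤f)

𝔼-++ : ∀ (f : X → ℚ) d e → 𝔼 f (d ++ e) ≡ 𝔼 f d + 𝔼 f e
𝔼-++ f []            e = sym (+-identityˡ _)
𝔼-++ f ((p , x) ∷ d) e = trans (cong (λ z → p * f x + z) (𝔼-++ f d e)) (sym (+-assoc (p * f x) _ _))

𝔼-scale : ∀ (f : X → ℚ) p d → 𝔼 f (List.map (λ (q , y) → (p * q , y)) d) ≡ p * 𝔼 f d
𝔼-scale f p []            = sym (*-zeroʳ p)
𝔼-scale f p ((q , x) ∷ d) = trans (cong₂ _+_ (*-assoc p q (f x)) (𝔼-scale f p d)) (sym (*-distribˡ-+ p _ _))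

𝔼->>= : ∀ (f : Y → ℚ) (d : Dist X) (k : X → Dist Y) → 𝔼 f (d >>= k) ≡ 𝔼 (λ x → 𝔼 f (k x)) d
𝔼->>= f []            k = refl
𝔼->>= f ((p , x) ∷ d) k = trans (𝔼-++ f (List.map _ (k x)) (d >>= k))
  (cong₂ _+_ (𝔼-scale f p (k x)) (𝔼->>= f d k))

𝔼-dirac : ∀ (f : X → ℚ) x → 𝔼 f (dirac x) ≡ f x
𝔼-dirac f x = trans (+-identityʳ _) (*-identityˡ (f x))

-- Multiplying by n avoids a division and covers n = 0, where `uniform` is the zero measure.
𝔼-uniform : ∀ (f : X → ℚ) n (h : ℕ → X) →
  fromℕ n * 𝔼 f (uniform n >>= λ k → dirac (h k)) ≡ rangeSum n (f ∘ h)
𝔼-uniform f zero      h = refl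
𝔼-uniform f n@(suc _) h = begin
  fromℕ n * 𝔼 f (uniform n >>= λ k → dirac (h k))
    ≡⟨ cong (fromℕ n *_) (𝔼->>= f (uniform n) (λ k → dirac (h k))) ⟩
  fromℕ n * 𝔼 (λ k → 𝔼 f (dirac (h k))) (uniform n)
    ≡⟨ cong (fromℕ n *_) (𝔼-cong (uniform n) (λ k → 𝔼-dirac f (h k))) ⟩
  fromℕ n * 𝔼 (f ∘ h) (uniform n)
    ≡⟨ cong (fromℕ n *_) (weighted (+ 1 / n) (f ∘ h) id n) ⟩
  fromℕ n * (+ 1 / n * rangeSum n (f ∘ h))
    ≡⟨ *-assoc (fromℕ n) (+ 1 / n) _ ⟨
  fromℕ n * (+ 1 / n) * rangeSum n (f ∘ h)
    ≡⟨ cong (_* rangeSum n (f ∘ h)) (fromℕ*1/ n) ⟩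
  1ℚ * rangeSum n (f ∘ h)
    ≡⟨ *-identityˡ _ ⟩
  rangeSum n (f ∘ h) ∎
  where
    open ≡-Reasoning
    -- The induction shortens the list but keeps the mass of each point, so δ is independent of m;
    -- the tail of the list is shifted by one, hence the general `g`.
    weighted : ∀ δ (f : ℕ → ℚ) (g : ℕ → ℕ) m →
      𝔼 f (List.map (λ k → (δ , k)) (List.applyUpTo g m)) ≡ δ * rangeSum m (f ∘ g)
    weighted δ f g zero    = sym (*-zeroʳ δ)
    weighted δ f g (suc m) = trans (cong (λ z → δ * f (g 0) + z) (weighted δ f (g ∘ suc) m)) (sym (*-distribˡ-+ δ _ _))

𝔼-uniform-≤ : ∀ {f : X → ℚ} {M} n .{{_ : ℕ.NonZero n}} (h : ℕ → X) →
  (∀ k → f (h k) ≤ M) → 𝔼 f (uniform n >>= λ k → dirac (h k)) ≤ M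
𝔼-uniform-≤ {f = f} {M} n h f≤M = *-cancelˡ-≤-pos (fromℕ n) {{normalize-pos n 1}} (begin
  fromℕ n * 𝔼 f (uniform n >>= λ k → dirac (h k))  ≡⟨ 𝔼-uniform f n h ⟩
  rangeSum n (f ∘ h)                                ≤⟨ sum-mono {n} (λ i → f≤M (toℕ i)) ⟩
  rangeSum n (λ _ → M)                              ≡⟨ rangeSum-const n M ⟩
  fromℕ n * M                                       ∎)
  where open ≤-Reasoning

dirac-nonNeg : ∀ (x : X) → NonNegative-Dist (dirac x)
dirac-nonNeg x = *≤* (ℤ.+≤+ ℕ.z≤n) ∷ []

uniform-nonNeg : ∀ n → NonNegative-Dist (uniform n)
uniform-nonNeg zero      = []
uniform-nonNeg n@(suc _) = All.map⁺ (All.universal (λ _ → 1/-nonNeg n) (List.upTo n))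

>>=-nonNeg : ∀ {d : Dist X} {k : X → Dist Y} →
  NonNegative-Dist d → (∀ x → NonNegative-Dist (k x)) → NonNegative-Dist (d >>= k)
>>=-nonNeg []          k≥0 = []
>>=-nonNeg (0≤p ∷ d≥0) k≥0 =
  All.++⁺ (All.map⁺ (All.map (*-nonNeg 0≤p) (k≥0 _))) (>>=-nonNeg d≥0 k≥0)

-- The limit criterion for absorbing chains

module Convergence
  (step : X → Dist X) (step-nonNeg : ∀ s → NonNegative-Dist (step s))
  (s₀ : X) (run : ℕ → Dist X)
  (run-zero : run 0 ≡ dirac s₀) (run-suc : ∀ n → run (suc n) ≡ (run n >>= step))
  where

  run-nonNeg : ∀ n → NonNegative-Dist (run n)
  run-nonNeg zero    = subst NonNegative-Dist (sym run-zero) (dirac-nonNeg s₀)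
  run-nonNeg (suc n) = subst NonNegative-Dist (sym (run-suc n)) (>>=-nonNeg (run-nonNeg n) step-nonNeg)

  𝔼-run-zero : ∀ f → 𝔼 f (run 0) ≡ f s₀
  𝔼-run-zero f = trans (cong (𝔼 f) run-zero) (𝔼-dirac f s₀)

  𝔼-run-suc : ∀ f n → 𝔼 f (run (suc n)) ≡ 𝔼 (λ s → 𝔼 f (step s)) (run n)
  𝔼-run-suc f n = trans (cong (𝔼 f) (run-suc n)) (𝔼->>= f (run n) step)

  𝔼-harmonic : ∀ {h} → (∀ s → 𝔼 h (step s) ≡ h s) → ∀ n → 𝔼 h (run n) ≡ h s₀
  𝔼-harmonic {h} harmonic zero    = 𝔼-run-zero h
  𝔼-harmonic {h} harmonic (suc n) =
    trans (𝔼-run-suc h n) (trans (𝔼-cong (run n) harmonic) (𝔼-harmonic harmonic n))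

  module _ {D V : X → ℚ}
    (D-decreasing : ∀ s → 𝔼 D (step s) ≤ D s)
    (V-drift : ∀ s → D s + 𝔼 V (step s) ≤ V s)
    (V-nonNeg : ∀ s → 0ℚ ≤ V s)
    where

    -- Every step pays the expectation of `D` out of that of `V`. As the expectation of `D` never
    -- increases, each of the first n payments is at least its current value, which therefore fits n
    -- times into `V s₀`.
    𝔼-drift : ∀ n → fromℕ n * 𝔼 D (run n) + 𝔼 V (run n) ≤ V s₀
    𝔼-drift zero    = ≤-reflexive (trans (cong₂ _+_ (*-zeroˡ (𝔼 D (run 0))) (𝔼-run-zero V)) (+-identityˡ (V s₀)))
    𝔼-drift (suc n) = begin
      fromℕ (suc n) * d′ + v′           ≡⟨ cong (λ z → z * d′ + v′) (fromℕ-suc n) ⟩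
      (1ℚ + ν) * d′ + v′                ≤⟨ +-monoˡ-≤ v′ (*-monoˡ 0≤1+ν d′≤d) ⟩
      (1ℚ + ν) * d + v′                 ≡⟨ cong (_+ v′) (*-distribʳ-+ d 1ℚ ν) ⟩
      1ℚ * d + ν * d + v′               ≡⟨ cong (λ z → z + ν * d + v′) (*-identityˡ d) ⟩
      d + ν * d + v′                    ≡⟨ solve 3 (λ d x v → d :+ x :+ v := x :+ (d :+ v)) refl d (ν * d) v′ ⟩
      ν * d + (d + v′)                  ≤⟨ +-monoʳ-≤ (ν * d) d+v′≤v ⟩
      ν * d + 𝔼 V (run n)               ≤⟨ 𝔼-drift n ⟩
      V s₀                              ∎
      where
        open ≤-Reasoning
        open +-*-Solver
        ν = fromℕ n
        d = 𝔼 D (run n)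
        d′ = 𝔼 D (run (suc n))
        v′ = 𝔼 V (run (suc n))
        0≤1+ν : 0ℚ ≤ 1ℚ + ν
        0≤1+ν = subst (0ℚ ≤_) (fromℕ-suc n) (fromℕ-nonNeg (suc n))
        d′≤d : d′ ≤ d
        d′≤d = subst (_≤ d) (sym (𝔼-run-suc D n)) (𝔼-mono (run-nonNeg n) D-decreasing)
        d+v′≤v : d + v′ ≤ 𝔼 V (run n)
        d+v′≤v = subst (_≤ 𝔼 V (run n))
          (trans (𝔼-+ D (λ s → 𝔼 V (step s)) (run n)) (cong (λ z → d + z) (sym (𝔼-run-suc V n))))
          (𝔼-mono (run-nonNeg n) V-drift)

    -- Taking expectations of the two bounds puts the constant `h s₀` between the probability of `P`
    -- and that probability plus the expectation of `D`, and the latter is at most `V s₀` / n by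
    -- `𝔼-drift`.
    absorption-limit : ∀ {P : X → Set} (P? : Decidable P) {h : X → ℚ} →
      (∀ s → 𝔼 h (step s) ≡ h s) →
      (∀ s → indicator P? s ≤ h s) → (∀ s → h s ≤ indicator P? s + D s) →
      (λ n → Pr P? (run n)) ⟶ h s₀
    absorption-limit P? {h} harmonic ind≤h h≤ind+D ε 0<ε
      with n₀ , C<n₀ε ← archimedean (V s₀) 0<ε = n₀ , close
      where
        close : ∀ n → n₀ ℕ.≤ n → ∣ Pr P? (run n) - h s₀ ∣ < ε
        close n n₀≤n = ≤-<-trans (∣-∣-≤ Pr≤h h≤Pr+d) d<ε
          where
            open ≤-Reasoning
            d = 𝔼 D (run n)
            Pr≤h : Pr P? (run n) ≤ h s₀
            Pr≤h = subst₂ _≤_ (sym (Pr≡𝔼 P? (run n))) (𝔼-harmonic harmonic n) (𝔼-mono (run-nonNeg n) ind≤h)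
            h≤Pr+d : h s₀ ≤ Pr P? (run n) + d
            h≤Pr+d = subst₂ _≤_ (𝔼-harmonic harmonic n)
              (trans (𝔼-+ (indicator P?) D (run n)) (cong (_+ d) (sym (Pr≡𝔼 P? (run n)))))
              (𝔼-mono (run-nonNeg n) h≤ind+D)
            -- The sandwich itself gives the sign: `d` dominates the nonnegative gap between `h s₀`
            -- and the probability of `P`.
            D-nonNeg : 0ℚ ≤ d
            D-nonNeg = ≤-trans (p-q≥0 Pr≤h) (subst (h s₀ - Pr P? (run n) ≤_)
              (solve 2 (λ p d → p :+ d :- p := d) refl (Pr P? (run n)) d) (+-monoˡ-≤ (- Pr P? (run n)) h≤Pr+d))
              where open +-*-Solver
            d<ε : d < ε
            d<ε = *-cancelˡ-<-nonNeg (fromℕ n₀) {{nonNegative (fromℕ-nonNeg n₀)}} (begin-strict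
              fromℕ n₀ * d                   ≤⟨ *-monoʳ-≤-nonNeg d {{nonNegative D-nonNeg}} (fromℤ-mono-≤ (ℤ.+≤+ n₀≤n)) ⟩
              fromℕ n * d                    ≡⟨ +-identityʳ _ ⟨
              fromℕ n * d + 0ℚ               ≤⟨ +-monoʳ-≤ (fromℕ n * d) (𝔼-nonNeg (run-nonNeg n) V-nonNeg) ⟩
              fromℕ n * d + 𝔼 V (run n)      ≤⟨ 𝔼-drift n ⟩
              V s₀                           <⟨ C<n₀ε ⟩
              fromℕ n₀ * ε                   ∎)

-- The sampler

-- The value of a trial that succeeds with probability q, earning u, and otherwise restarts, which
-- is worth a.
mixture : ℚ → ℚ → ℚ → ℚ
mixture q u a = q * u + (1ℚ - q) * a

-- The tally for one level in the outer draw: ν values of x accept at once and the tie accepts with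
-- probability q, so u gets weight ν + q out of the 1 + ν values.
add-mixture : ∀ ν q u a → ν * u + mixture q u a ≡ (ν + q) * u + ((1ℚ + ν) - (ν + q)) * a
add-mixture ν q u a = solve 5 (λ ν υ q α o → ν :* υ :+ (q :* υ :+ (o :- q) :* α)
                               := (ν :+ q) :* υ :+ ((o :+ ν) :- (ν :+ q)) :* α)
               refl ν u q a 1ℚ
  where open +-*-Solver

-- The tally for one digit draw: τ values accept, one ties, and ν restart.
pool-mixture : ∀ τ q ν u a →
  τ * u + mixture q u a + ν * a ≡ (τ + q) * u + ((τ + (1ℚ + ν)) - (τ + q)) * a
pool-mixture τ q ν u a = solve 6 (λ τ υ φ α ν o → τ :* υ :+ (φ :* υ :+ (o :- φ) :* α) :+ ν :* α
                               := (τ :+ φ) :* υ :+ ((τ :+ (o :+ ν)) :- (τ :+ φ)) :* α)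
             refl τ u q a ν 1ℚ
  where open +-*-Solver

scale-mixture : ∀ β q u a → β * q * u + (β - β * q) * a ≡ β * mixture q u a
scale-mixture β q u a = trans
  -- The solver treats `1ℚ` as an indeterminate `o`, so the lone β has to become β times 1 before
  -- both sides agree as polynomials.
  (cong (λ z → β * q * u + (z - β * q) * a) (sym (*-identityʳ β)))
  (solve 5 (λ β q υ α o → β :* q :* υ :+ (β :* o :- β :* q) :* α := β :* (q :* υ :+ (o :- q) :* α))
    refl β q u a 1ℚ)
  where open +-*-Solver

mixture-zero : ∀ u a → mixture 0ℚ u a ≡ a
mixture-zero u a = trans (cong₂ _+_ (*-zeroˡ u) (*-identityˡ a)) (+-identityˡ a)

mixture-nonNeg : ∀ {q u a} → 0ℚ ≤ q → q ≤ 1ℚ → 0ℚ ≤ u → 0ℚ ≤ a → 0ℚ ≤ mixture q u a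
mixture-nonNeg 0≤q q≤1 0≤u 0≤a = +-mono-≤ (*-nonNeg 0≤q 0≤u) (*-nonNeg (p-q≥0 q≤1) 0≤a)

mixture-≤1 : ∀ {q u a} → 0ℚ ≤ q → q ≤ 1ℚ → u ≤ 1ℚ → a ≤ 1ℚ → mixture q u a ≤ 1ℚ
mixture-≤1 {q} {u} {a} 0≤q q≤1 u≤1 a≤1 = begin
  q * u + (1ℚ - q) * a    ≤⟨ +-mono-≤ (*-monoˡ 0≤q u≤1) (*-monoˡ (p-q≥0 q≤1) a≤1) ⟩
  q * 1ℚ + (1ℚ - q) * 1ℚ  ≡⟨ cong₂ _+_ (*-identityʳ q) (*-identityʳ (1ℚ - q)) ⟩
  q + (1ℚ - q)            ≡⟨ solve 2 (λ q o → q :+ (o :- q) := o) refl q 1ℚ ⟩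
  1ℚ                      ∎
  where
    open ≤-Reasoning
    open +-*-Solver

-- Acceptance probabilities and expected rewards of one step

module Analysis {b : ℕ} (c : Config b) (G : ℤ) where
  open Config c
  open Sampler c G

  B : ℕ
  B = 2 ^ b

  instance
    B≢0 : ℕ.NonZero B
    B≢0 = 2^n≢0 b

  scaledSS : Fin N → ℕ → ℚ
  scaledSS i m = fromℕ (SS i) * exp2 (exponent i m)

  -- The probability of accepting level i when about to draw the m-th digit.
  accept : Fin N → ℕ → ℚ
  accept i m = frac (scaledSS i m * (+ 1 / B))

  shiftedW : Fin N → ℚ
  shiftedW i = W i * exp2 G

  descale : ∀ n k → fromℕ n * exp2 (k ℤ.+ + b) * (+ 1 / B) ≡ fromℕ n * exp2 k
  descale n k = begin
    s * exp2 (k ℤ.+ + b) * δ           ≡⟨ cong (λ z → s * z * δ) (exp2-+ k (+ b)) ⟩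
    s * (exp2 k * fromℕ B) * δ         ≡⟨ regroup s (exp2 k) (fromℕ B) δ ⟩
    s * exp2 k * (fromℕ B * δ)         ≡⟨ cong (s * exp2 k *_) (fromℕ*1/ B) ⟩
    s * exp2 k * 1ℚ                    ≡⟨ *-identityʳ _ ⟩
    s * exp2 k                         ∎
    where
      open ≡-Reasoning
      s = fromℕ n
      regroup : ∀ s e β δ → s * (e * β) * δ ≡ s * e * (β * δ)
      regroup = solve 4 (λ s e β δ → s :* (e :* β) :* δ := s :* e :* (β :* δ)) refl
        where open +-*-Solver
      δ = + 1 / B

  exponent-suc : ∀ i m → exponent i (suc m) ≡ exponent i m ℤ.+ + b
  exponent-suc i m = trans
    (cong (λ n → level i ℤ.+ G ℤ.+ + n) (ℕ.+-comm b (m ℕ.* b)))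
    (sym (ℤ.+-assoc (level i ℤ.+ G) (+ (m ℕ.* b)) (+ b)))

  -- Passing to the next digit raises the exponent by b, which cancels the factor 1 / B. The result
  -- is the fractional part that `leading-digit` leaves over after digit m.
  accept-suc : ∀ i m → accept i (suc m) ≡ frac (scaledSS i m)
  accept-suc i m = cong frac (trans
    (cong (λ k → fromℕ (SS i) * exp2 k * (+ 1 / B)) (exponent-suc i m))
    (descale (SS i) (exponent i m)))

  accept-1 : ∀ i → accept i 1 ≡ frac (shiftedW i)
  accept-1 i = trans (accept-suc i 0) (cong frac (begin
    fromℕ (SS i) * exp2 (exponent i 0)             ≡⟨ cong (λ k → fromℕ (SS i) * exp2 k) (ℤ.+-identityʳ (level i ℤ.+ G)) ⟩
    fromℕ (SS i) * exp2 (level i ℤ.+ G)            ≡⟨ cong (fromℕ (SS i) *_) (exp2-+ (level i) G) ⟩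
    fromℕ (SS i) * (exp2 (level i) * exp2 G)       ≡⟨ *-assoc (fromℕ (SS i)) (exp2 (level i)) (exp2 G) ⟨
    shiftedW i                                     ∎))
    where open ≡-Reasoning

  -- At a nonnegative exponent the scaled significand sum is an integer. All further digits are
  -- zero, so abandoning the iteration on a tie loses no acceptance probability.
  accept-exhausted : ∀ i m → ℤ.0ℤ ℤ.≤ exponent i m → frac (scaledSS i m) ≡ 0ℚ
  accept-exhausted i m 0≤e = trans
    (cong frac (trans (cong (fromℕ (SS i) *_) (exp2-nonNeg-integer 0≤e))
                 (sym (fromℕ-homo-* (SS i) (2 ^ ℤ.∣ exponent i m ∣)))))
    (frac-fromℤ (+ (SS i ℕ.* 2 ^ ℤ.∣ exponent i m ∣)))

  shiftedW-nonNeg : ∀ i → 0ℚ ≤ shiftedW i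
  shiftedW-nonNeg i = *-nonNeg (scaled-nonNeg (SS i) (level i))
    (nonNegative⁻¹ (exp2 G) {{pos⇒nonNeg (exp2 G) {{exp2-pos G}}}})

  A-empty : ∀ {i} → SS i ≡ 0 → A G i ≡ 0
  A-empty {i} SS≡0 = cong (if_then 0 else ℤ.∣ floor (shiftedW i) ∣ ℕ.+ 1) (dec-true (SS i ℕ.≟ 0) SS≡0)

  A-nonempty : ∀ {i} → SS i ≢ 0 → A G i ≡ suc ℤ.∣ floor (shiftedW i) ∣
  A-nonempty {i} SS≢0 = trans
    (cong (if_then 0 else ℤ.∣ floor (shiftedW i) ∣ ℕ.+ 1) (dec-false (SS i ℕ.≟ 0) SS≢0))
    (ℕ.+-comm _ 1)

  -- For a nonempty level the integer part of the shifted weight counts the values of x that accept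
  -- outright, and the fractional part is the acceptance probability of the single tie value. An
  -- empty level occupies no values of x.
  A-cases : ∀ i → (A G i ≡ 0 × shiftedW i ≡ 0ℚ) ⊎
                  (∃[ a ] A G i ≡ suc a × shiftedW i ≡ fromℕ a + accept i 1)
  A-cases i = case SS i ℕ.≟ 0 of λ where
    (yes SS≡0) → inj₁ (A-empty SS≡0 , (begin
      fromℕ (SS i) * exp2 (level i) * exp2 G ≡⟨ cong (λ n → fromℕ n * exp2 (level i) * exp2 G) SS≡0 ⟩
      0ℚ * exp2 (level i) * exp2 G           ≡⟨ cong (_* exp2 G) (*-zeroˡ (exp2 (level i))) ⟩
      0ℚ * exp2 G                            ≡⟨ *-zeroˡ (exp2 G) ⟩
      0ℚ                                     ∎))
    (no SS≢0) → inj₂ (ℤ.∣ floor (shiftedW i) ∣ , A-nonempty SS≢0 , (begin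
      shiftedW i                                          ≡⟨ floor+frac (shiftedW i) ⟨
      fromℤ (floor (shiftedW i)) + frac (shiftedW i)      ≡⟨ cong₂ (λ k q → fromℤ k + q) (floor-nonNeg (shiftedW-nonNeg i)) (accept-1 i) ⟨
      fromℕ ℤ.∣ floor (shiftedW i) ∣ + accept i 1         ∎))
   where open ≡-Reasoning

  shiftedW-≤-A : ∀ i → shiftedW i ≤ fromℕ (A G i)
  shiftedW-≤-A i = case A-cases i of λ where
    (inj₁ (A≡0 , w≡0))    → ≤-reflexive (trans w≡0 (cong fromℕ (sym A≡0)))
    (inj₂ (a , A≡ , w≡)) → begin
      shiftedW i              ≡⟨ w≡ ⟩
      fromℕ a + accept i 1    ≤⟨ +-monoʳ-≤ (fromℕ a) (frac-≤1 (scaledSS i 1 * (+ 1 / B))) ⟩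
      fromℕ a + 1ℚ            ≡⟨ +-comm (fromℕ a) 1ℚ ⟩
      1ℚ + fromℕ a            ≡⟨ fromℕ-suc a ⟨
      fromℕ (suc a)           ≡⟨ cong fromℕ A≡ ⟨
      fromℕ (A G i)           ∎
   where open ≤-Reasoning

  open ListSum ℕ.+-0-commutativeMonoid using () renaming (listSum to listSumℕ; listSum-dropWhile to listSumℕ-dropWhile; listSum-reverse to listSumℕ-reverse; listSum-tabulate to listSumℕ-tabulate)
  open ListSum +-0-commutativeMonoid using () renaming (listSum to listSumℚ; listSum-dropWhile to listSumℚ-dropWhile; listSum-reverse to listSumℚ-reverse; listSum-tabulate to listSumℚ-tabulate)

  listSum-A-scanOrder : listSumℕ (A G) scanOrder ≡ ΣA G
  listSum-A-scanOrder = trans (listSumℕ-dropWhile (λ i → SS i ℕ.≟ 0) (A G) A-empty (reverse (allFin N)))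
    (trans (listSumℕ-reverse (A G) (allFin N)) (listSumℕ-tabulate (A G) id))

  reward : (Fin N → ℚ) → ℚ → State → ℚ
  reward u a outer        = a
  reward u a (refine i m) = mixture (accept i m) (u i) a
  reward u a (returned i) = u i
  -- Being neither running nor returned, `stuck` must have value 0 for the bounds `lower` and
  -- `upper` below.
  reward u a stuck        = 0ℚ

  module _ (u : Fin N → ℚ) (a : ℚ) where

    -- Both outcomes of a tie obey one formula: when the digits are exhausted the remaining fraction
    -- is 0 and the mixture collapses to the restart value a.
    reward-tie : ∀ i m →
      reward u a (if does (ℤ.0ℤ ℤ.≤? exponent i m) then outer else refine i (suc m))
        ≡ mixture (frac (scaledSS i m)) (u i) a
    reward-tie i m with ℤ.0ℤ ℤ.≤? exponent i m
    ... | yes 0≤e = sym (trans (cong (λ q → mixture q (u i) a) (accept-exhausted i m 0≤e)) (mixture-zero (u i) a))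
    ... | no _    = cong (λ q → mixture q (u i) a) (accept-suc i m)

    -- Of the B values of r, t earn u, the tie earns the mixture for the remaining fraction φ, and
    -- the others earn a. The total weight t + φ of u equals B q by `leading-digit`.
    reward-refine : ∀ i m → 𝔼 (reward u a) (step (refine i m)) ≡ reward u a (refine i m)
    reward-refine i m = fromℕ-*-cancelˡ B (begin
      fromℕ B * 𝔼 (reward u a) (step (refine i m))
        ≡⟨ 𝔼-uniform (reward u a) B (compareDigit i m) ⟩
      rangeSum B f
        ≡⟨ cong (λ n → rangeSum n f) B≡ ⟩
      rangeSum (t ℕ.+ suc n) f
        ≡⟨ rangeSum-tricho {t} {n} f
             (λ k<t → cong (reward u a) (tricho-< k<t))
             (trans (cong (reward u a) (tricho-≡ {x = t} {y = t} refl)) (reward-tie i m)) ⟩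
      fromℕ t * u i + mixture φ (u i) a + rangeSum n (λ k → f (t ℕ.+ suc k))
        ≡⟨ cong (λ z → fromℕ t * u i + mixture φ (u i) a + z)
             (trans (rangeSum-cong n (λ {k} _ → cong (reward u a) (tricho-> (t<t+suc k)))) (rangeSum-const n a)) ⟩
      fromℕ t * u i + mixture φ (u i) a + fromℕ n * a
        ≡⟨ pool-mixture (fromℕ t) φ (fromℕ n) (u i) a ⟩
      (fromℕ t + φ) * u i + ((fromℕ t + (1ℚ + fromℕ n)) - (fromℕ t + φ)) * a
        ≡⟨ cong₂ (λ x y → x * u i + (y - x) * a) (leading-digit B (scaledSS i m)) (sym fromℕ-B) ⟩
      fromℕ B * q * u i + (fromℕ B - fromℕ B * q) * a
        ≡⟨ scale-mixture (fromℕ B) q (u i) a ⟩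
      fromℕ B * mixture q (u i) a ∎)
      where
        open ≡-Reasoning
        f = λ r → reward u a (compareDigit i m r)
        t = digit i m
        n = B ∸ suc t
        φ = frac (scaledSS i m)
        q = accept i m
        t<t+suc : ∀ k → t ℕ.< t ℕ.+ suc k
        t<t+suc k = ℕ.m<m+n t (ℕ.s≤s ℕ.z≤n)
        B≡ : B ≡ t ℕ.+ suc n
        B≡ = sym (trans (ℕ.+-suc t n) (ℕ.m+[n∸m]≡n (ℤ.n%ℕd<d (floor (scaledSS i m)) B)))
        fromℕ-B : fromℕ B ≡ fromℕ t + (1ℚ + fromℕ n)
        fromℕ-B = trans (cong fromℕ B≡) (trans (fromℕ-homo-+ t (suc n)) (cong (λ z → fromℕ t + z) (fromℕ-suc n)))

    -- The total expected reward from the `A G i` values of x that fall to level i.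
    contribution : Fin N → ℚ
    contribution i = shiftedW i * u i + (fromℕ (A G i) - shiftedW i) * a

    contribution-empty : ∀ {i} → A G i ≡ 0 → shiftedW i ≡ 0ℚ → contribution i ≡ 0ℚ
    contribution-empty {i} A≡0 w≡0 = begin
      contribution i                 ≡⟨ cong₂ (λ n w → w * u i + (fromℕ n - w) * a) A≡0 w≡0 ⟩
      0ℚ * u i + 0ℚ * a              ≡⟨ cong₂ _+_ (*-zeroˡ (u i)) (*-zeroˡ a) ⟩
      0ℚ                             ∎
      where open ≡-Reasoning

    -- Induction along the scan. After level i has taken its values, subtracting `A G i` turns the
    -- rest into 1, ..., S for the remaining levels. The range is exactly as long as the levels
    -- fill, so it is empty when the list ends and `stuck` is not reached.
    rangeSum-scan : ∀ is → rangeSum (listSumℕ (A G) is) (λ k → reward u a (scan is (suc k)))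
                             ≡ listSumℚ contribution is
    rangeSum-scan []       = refl
    rangeSum-scan (i ∷ is) = case A-cases i of λ where
      (inj₁ (A≡0 , w≡0))    → scan-empty A≡0 w≡0
      (inj₂ (n , A≡ , w≡)) → scan-nonempty n A≡ w≡
     where
     open ≡-Reasoning
     S = listSumℕ (A G) is
     f = λ k → reward u a (scan (i ∷ is) (suc k))

     scan-empty : A G i ≡ 0 → shiftedW i ≡ 0ℚ →
       rangeSum (A G i ℕ.+ S) f ≡ contribution i + listSumℚ contribution is
     scan-empty A≡0 w≡0 = begin
      rangeSum (A G i ℕ.+ S) f                   ≡⟨ cong (λ n → rangeSum (n ℕ.+ S) f) A≡0 ⟩
      -- The threshold is 0 and x is at least 1, so the scan passes an empty level with x unchanged.
      rangeSum S f                               ≡⟨ rangeSum-cong S (λ {k} _ → cong (reward u a) (trans (tricho-> (A< k)) (cong (λ n → scan is (suc k ∸ n)) A≡0))) ⟩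
      rangeSum S (λ k → reward u a (scan is (suc k))) ≡⟨ rangeSum-scan is ⟩
      listSumℚ contribution is                   ≡⟨ +-identityˡ _ ⟨
      0ℚ + listSumℚ contribution is              ≡⟨ cong (_+ listSumℚ contribution is) (contribution-empty A≡0 w≡0) ⟨
      contribution i + listSumℚ contribution is  ∎
      where
        A< : ∀ k → A G i ℕ.< suc k
        A< k = subst (ℕ._< suc k) (sym A≡0) (ℕ.s≤s ℕ.z≤n)

     scan-nonempty : ∀ n → A G i ≡ suc n → shiftedW i ≡ fromℕ n + accept i 1 →
       rangeSum (A G i ℕ.+ S) f ≡ contribution i + listSumℚ contribution is
     scan-nonempty n A≡ w≡ = begin
      rangeSum (A G i ℕ.+ S) f
        ≡⟨ cong (λ l → rangeSum l f) (trans (cong (ℕ._+ S) A≡) (sym (ℕ.+-suc n S))) ⟩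
      rangeSum (n ℕ.+ suc S) f
        -- The index k is x - 1, so the tie x = `A G i` = `suc n` sits at k = n.
        ≡⟨ rangeSum-tricho {n} {S} f
             (λ {k} k<n → cong (reward u a) (tricho-< (subst (suc k ℕ.<_) (sym A≡) (ℕ.s≤s k<n))))
             (cong (reward u a) (tricho-≡ (sym A≡))) ⟩
      fromℕ n * u i + mixture (accept i 1) (u i) a + rangeSum S (λ k → f (n ℕ.+ suc k))
        ≡⟨ cong₂ _+_
             (add-mixture (fromℕ n) (accept i 1) (u i) a)
             (trans (rangeSum-cong S (λ {k} _ → cong (reward u a) (rest k))) (rangeSum-scan is)) ⟩
      (fromℕ n + accept i 1) * u i + ((1ℚ + fromℕ n) - (fromℕ n + accept i 1)) * a + listSumℚ contribution is
        ≡⟨ cong₂ (λ w α → w * u i + (α - w) * a + listSumℚ contribution is) (sym w≡)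
             (trans (sym (fromℕ-suc n)) (cong fromℕ (sym A≡))) ⟩
      contribution i + listSumℚ contribution is ∎
      where
        rest : ∀ k → scan (i ∷ is) (suc (n ℕ.+ suc k)) ≡ scan is (suc k)
        rest k = trans (tricho-> (subst (ℕ._< suc (n ℕ.+ suc k)) (sym A≡) (ℕ.s≤s (ℕ.m<m+n n (ℕ.s≤s ℕ.z≤n)))))
          (cong (scan is) (trans (cong (suc (n ℕ.+ suc k) ∸_) A≡) (ℕ.m+n∸m≡n n (suc k))))

    -- No relation between u and a is assumed, so that this serves the harmonic functions as well as
    -- the potential, where `outer` must lose value.
    reward-outer : fromℕ (ΣA G) * 𝔼 (reward u a) (step outer)
                     ≡ sum (λ i → shiftedW i * u i) + (fromℕ (ΣA G) - sum shiftedW) * a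
    reward-outer = begin
      fromℕ (ΣA G) * 𝔼 (reward u a) (step outer)
        ≡⟨ 𝔼-uniform (reward u a) (ΣA G) (λ k → scan scanOrder (suc k)) ⟩
      rangeSum (ΣA G) (λ k → reward u a (scan scanOrder (suc k)))
        ≡⟨ cong (λ n → rangeSum n (λ k → reward u a (scan scanOrder (suc k)))) listSum-A-scanOrder ⟨
      rangeSum (listSumℕ (A G) scanOrder) (λ k → reward u a (scan scanOrder (suc k)))
        ≡⟨ rangeSum-scan scanOrder ⟩
      listSumℚ contribution scanOrder
        ≡⟨ listSumℚ-dropWhile (λ i → SS i ℕ.≟ 0) contribution drop-empty (reverse (allFin N)) ⟩
      listSumℚ contribution (reverse (allFin N))
        ≡⟨ listSumℚ-reverse contribution (allFin N) ⟩
      listSumℚ contribution (allFin N)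
        ≡⟨ listSumℚ-tabulate contribution id ⟩
      sum contribution
        ≡⟨ ∑-distrib-+ (λ i → shiftedW i * u i) (λ i → (fromℕ (A G i) - shiftedW i) * a) ⟩
      sum (λ i → shiftedW i * u i) + sum (λ i → (fromℕ (A G i) - shiftedW i) * a)
        ≡⟨ cong (λ z → sum (λ i → shiftedW i * u i) + z) (trans (sym (*-distribʳ-sum a (λ i → fromℕ (A G i) - shiftedW i))) (cong (_* a) remaining)) ⟩
      sum (λ i → shiftedW i * u i) + (fromℕ (ΣA G) - sum shiftedW) * a ∎
      where
        open ≡-Reasoning
        drop-empty : ∀ {i} → SS i ≡ 0 → contribution i ≡ 0ℚ
        drop-empty {i} SS≡0 = contribution-empty (A-empty SS≡0)
          (≤-antisym (subst (λ n → shiftedW i ≤ fromℕ n) (A-empty SS≡0) (shiftedW-≤-A i)) (shiftedW-nonNeg i))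
        remaining : sum (λ i → fromℕ (A G i) - shiftedW i) ≡ fromℕ (ΣA G) - sum shiftedW
        remaining = begin
          σ                                           ≡⟨ p+q-q≡p σ (sum shiftedW) ⟨
          σ + sum shiftedW - sum shiftedW             ≡⟨ cong (_- sum shiftedW) (∑-distrib-+ (λ i → fromℕ (A G i) - shiftedW i) shiftedW) ⟨
          sum (λ i → fromℕ (A G i) - shiftedW i + shiftedW i) - sum shiftedW
            ≡⟨ cong (_- sum shiftedW) (sum-cong-≗ λ i → p-q+q≡p (fromℕ (A G i)) (shiftedW i)) ⟩
          sum (λ i → fromℕ (A G i)) - sum shiftedW    ≡⟨ cong (_- sum shiftedW) (sum-fromℕ (A G)) ⟩
          fromℕ (ΣA G) - sum shiftedW                 ∎
          where
            σ = sum (λ i → fromℕ (A G i) - shiftedW i)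

-- Harmonicity, the potential and absorption

module Lyapunov {b : ℕ} (2≤b : 2 ℕ.≤ b) (c : Config b) (nonempty : Config.Nonempty c) (G : ℤ) where
  open Config c
  open Sampler c G
  open Analysis c G

  K : ℕ
  K = ℤ.∣ lo ℤ.+ G ∣

  -- The lowest level starts at exponent `lo` + G ≥ -K, and every digit adds b ≥ 1. The bound is
  -- therefore uniform over all levels.
  K-exhausts : ∀ i {m} → K ℕ.≤ m → ℤ.0ℤ ℤ.≤ exponent i m
  K-exhausts i {m} K≤m = begin
    ℤ.0ℤ                                     ≡⟨ ℤ.+-inverseˡ (+ K) ⟨
    ℤ.- (+ K) ℤ.+ + K                        ≤⟨ ℤ.+-mono-≤ (-∣i∣≤i (lo ℤ.+ G)) (ℤ.+≤+ K≤i+mb) ⟩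
    (lo ℤ.+ G) ℤ.+ (+ toℕ i ℤ.+ + (m ℕ.* b)) ≡⟨ ℤ.+-assoc (lo ℤ.+ G) (+ toℕ i) (+ (m ℕ.* b)) ⟨
    lo ℤ.+ G ℤ.+ + toℕ i ℤ.+ + (m ℕ.* b)     ≡⟨ cong (ℤ._+ + (m ℕ.* b)) swap ⟩
    exponent i m                             ∎
    where
      open ℤ.≤-Reasoning
      swap : lo ℤ.+ G ℤ.+ + toℕ i ≡ lo ℤ.+ + toℕ i ℤ.+ G
      swap = trans (ℤ.+-assoc lo G (+ toℕ i)) (trans (cong (λ z → lo ℤ.+ z) (ℤ.+-comm G (+ toℕ i))) (sym (ℤ.+-assoc lo (+ toℕ i) G)))
      instance
        b≢0 : ℕ.NonZero b
        b≢0 = ℕ.>-nonZero (ℕ.≤-trans (ℕ.s≤s ℕ.z≤n) 2≤b)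
      K≤i+mb : K ℕ.≤ toℕ i ℕ.+ m ℕ.* b
      K≤i+mb = ℕ.≤-trans K≤m (ℕ.≤-trans (ℕ.m≤m*n m b) (ℕ.m≤n+m (m ℕ.* b) (toℕ i)))

  instance
    ΣW-pos : Positive ΣW
    ΣW-pos = nonNeg∧nonZero⇒pos ΣW
      {{nonNegative (sumℚ-nonNeg W (λ i → scaled-nonNeg (SS i) (level i)))}} {{ΣW≢0 nonempty}}

  -- This is M(G), so that an outer iteration returns with probability `Ω` / `ΣA G`.
  Ω : ℚ
  Ω = sum shiftedW

  Ω≡ : Ω ≡ ΣW * exp2 G
  Ω≡ = sym (*-distribʳ-sum (exp2 G) W)

  instance
    Ω-pos : Positive Ω
    Ω-pos = subst Positive (sym Ω≡) (pos*pos⇒pos ΣW (exp2 G) {{exp2-pos G}})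

  instance
    ΣA≢0 : ℕ.NonZero (ΣA G)
    ΣA≢0 = ℕ.≢-nonZero λ ΣA≡0 → <-irrefl refl (<-≤-trans (positive⁻¹ Ω)
      (subst (λ n → Ω ≤ fromℕ n) ΣA≡0 (≤-trans (sum-mono shiftedW-≤-A) (≤-reflexive (sum-fromℕ (A G))))))

  step-nonNeg : ∀ s → NonNegative-Dist (step s)
  step-nonNeg outer        = >>=-nonNeg (uniform-nonNeg (ΣA G)) (λ k → dirac-nonNeg (scan scanOrder (suc k)))
  step-nonNeg (refine i m) = >>=-nonNeg (uniform-nonNeg B) (λ r → dirac-nonNeg (compareDigit i m r))
  step-nonNeg (returned i) = dirac-nonNeg (returned i)
  step-nonNeg stuck        = dirac-nonNeg stuck

  -- The balance hypothesis enters at `outer`: it makes the accepted weight `Ω` worth a on average,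
  -- the same as the restarting weight `ΣA G` - `Ω`.
  reward-harmonic : ∀ u a → sum (λ i → shiftedW i * u i) ≡ Ω * a →
    ∀ s → 𝔼 (reward u a) (step s) ≡ reward u a s
  reward-harmonic u a Σwu≡Ωa outer = fromℕ-*-cancelˡ (ΣA G) (begin
    fromℕ (ΣA G) * 𝔼 (reward u a) (step outer)                      ≡⟨ reward-outer u a ⟩
    sum (λ i → shiftedW i * u i) + (fromℕ (ΣA G) - Ω) * a          ≡⟨ cong (_+ (fromℕ (ΣA G) - Ω) * a) Σwu≡Ωa ⟩
    Ω * a + (fromℕ (ΣA G) - Ω) * a                                 ≡⟨ *-distribʳ-+ a Ω (fromℕ (ΣA G) - Ω) ⟨
    (Ω + (fromℕ (ΣA G) - Ω)) * a                                   ≡⟨ cong (_* a) (trans (+-comm Ω _) (p-q+q≡p (fromℕ (ΣA G)) Ω)) ⟩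
    fromℕ (ΣA G) * a                                               ∎)
    where open ≡-Reasoning
  reward-harmonic u a _ (refine i m) = reward-refine u a i m
  reward-harmonic u a _ (returned i) = 𝔼-dirac (reward u a) (returned i)
  reward-harmonic u a _ stuck        = 𝔼-dirac (reward u a) stuck

  reward-nonNeg : ∀ {u a} → (∀ i → 0ℚ ≤ u i) → 0ℚ ≤ a → ∀ s → 0ℚ ≤ reward u a s
  reward-nonNeg 0≤u 0≤a outer        = 0≤a
  reward-nonNeg 0≤u 0≤a (refine i m) = mixture-nonNeg
    (frac-nonNeg (scaledSS i m * (+ 1 / B))) (frac-≤1 (scaledSS i m * (+ 1 / B))) (0≤u i) 0≤a
  reward-nonNeg 0≤u 0≤a (returned i) = 0≤u i
  reward-nonNeg 0≤u 0≤a stuck        = ≤-refl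

  running : State → ℚ
  running outer        = 1ℚ
  running (refine _ _) = 1ℚ
  running (returned _) = 0ℚ
  running stuck        = 0ℚ

  running-≤1 : ∀ s → running s ≤ 1ℚ
  running-≤1 outer        = ≤-refl
  running-≤1 (refine _ _) = ≤-refl
  running-≤1 (returned _) = 0≤1
  running-≤1 stuck        = 0≤1

  running-decreasing : ∀ s → 𝔼 running (step s) ≤ running s
  running-decreasing outer        = 𝔼-uniform-≤ (ΣA G) (λ k → scan scanOrder (suc k)) (λ k → running-≤1 (scan scanOrder (suc k)))
  running-decreasing (refine i m) = 𝔼-uniform-≤ B (compareDigit i m) (λ r → running-≤1 (compareDigit i m r))
  running-decreasing (returned i) = ≤-reflexive (𝔼-dirac running (returned i))
  running-decreasing stuck        = ≤-reflexive (𝔼-dirac running stuck)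

  -- A bound on the digit draws left in the current refinement. The successor counts the draw about
  -- to be made, which is the last one once m ≥ K.
  digitsLeft : State → ℚ
  digitsLeft (refine i m) = fromℕ (suc (K ∸ m))
  digitsLeft _            = 0ℚ

  digitsLeft-nonNeg : ∀ s → 0ℚ ≤ digitsLeft s
  digitsLeft-nonNeg outer        = ≤-refl
  digitsLeft-nonNeg (refine i m) = fromℕ-nonNeg (suc (K ∸ m))
  digitsLeft-nonNeg (returned i) = ≤-refl
  digitsLeft-nonNeg stuck        = ≤-refl

  digitsLeft-≤ : ∀ s → digitsLeft s ≤ fromℕ (suc K)
  digitsLeft-≤ outer        = fromℕ-nonNeg (suc K)
  digitsLeft-≤ (refine i m) = fromℕ-mono-≤ (ℕ.s≤s (ℕ.m∸n≤m K m))
  digitsLeft-≤ (returned i) = fromℕ-nonNeg (suc K)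
  digitsLeft-≤ stuck        = fromℕ-nonNeg (suc K)

  digitsLeft-compareDigit : ∀ i m r → digitsLeft (compareDigit i m r) ≤ fromℕ (K ∸ m)
  digitsLeft-compareDigit i m r = tricho-elim (λ s → digitsLeft s ≤ fromℕ (K ∸ m)) r (digit i m)
    (fromℕ-nonNeg (K ∸ m)) tie (fromℕ-nonNeg (K ∸ m))
    where
      tie : digitsLeft (if does (ℤ.0ℤ ℤ.≤? exponent i m) then outer else refine i (suc m)) ≤ fromℕ (K ∸ m)
      tie with ℤ.0ℤ ℤ.≤? exponent i m
      ... | yes _  = fromℕ-nonNeg (K ∸ m)
      -- If the refinement continues, then m < K by `K-exhausts`, so the truncated subtraction
      -- really drops by one.
      ... | no 0≰e = ≤-reflexive (cong fromℕ (sym (ℕ.+-∸-assoc 1 (ℕ.≰⇒> (0≰e ∘ K-exhausts i)))))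

  -- `Λ` bounds the number of draws in one outer iteration: one for x and at most `suc K` digits.
  α Λ : ℚ
  α = fromℕ (ΣA G)
  Λ = 1ℚ + fromℕ (suc K)

  instance
    Ω≢0 : ℚ.NonZero Ω
    Ω≢0 = pos⇒nonZero Ω

  -- The solution of α (Λ + C) - Ω C = α C, the drift condition at `outer`.
  C : ℚ
  C = α * Λ ÷ Ω

  C-nonNeg : 0ℚ ≤ C
  C-nonNeg = *-nonNeg
    (*-nonNeg (fromℕ-nonNeg (ΣA G)) (+-mono-≤ 0≤1 (fromℕ-nonNeg (suc K))))
    (pos⇒0≤1/ Ω)

  ΩC : Ω * C ≡ α * Λ
  ΩC = *-÷-cancel (α * Λ) Ω

  -- A bound on the expected number of draws to come. A return costs nothing and a restart costs
  -- `C`, which is `Λ` times the mean number α / Ω of outer iterations; `digitsLeft` accounts for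
  -- the refinement in progress.
  potential : State → ℚ
  potential s = reward (λ _ → 0ℚ) C s + digitsLeft s

  potential-nonNeg : ∀ s → 0ℚ ≤ potential s
  potential-nonNeg s = +-mono-≤ (reward-nonNeg (λ _ → ≤-refl) C-nonNeg s) (digitsLeft-nonNeg s)

  -- The next iteration fails with probability 1 - Ω / α, and `C` is scaled so that the saving C Ω /
  -- α is exactly `Λ`.
  restart-outer : 𝔼 (reward (λ _ → 0ℚ) C) (step outer) ≡ C - Λ
  restart-outer = fromℕ-*-cancelˡ (ΣA G) (begin
    α * 𝔼 (reward (λ _ → 0ℚ) C) (step outer)            ≡⟨ reward-outer (λ _ → 0ℚ) C ⟩
    sum (λ i → shiftedW i * 0ℚ) + (α - Ω) * C           ≡⟨ cong (_+ (α - Ω) * C) (trans (sum-cong-≗ (λ i → *-zeroʳ (shiftedW i))) (sum-replicate-zero N)) ⟩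
    0ℚ + (α - Ω) * C                                    ≡⟨ +-identityˡ _ ⟩
    (α - Ω) * C                                         ≡⟨ distrib α Ω C ⟩
    α * C - Ω * C                                       ≡⟨ cong (λ z → α * C - z) ΩC ⟩
    α * C - α * Λ                                       ≡⟨ factor α C Λ ⟩
    α * (C - Λ)                                         ∎)
    where
      open ≡-Reasoning
      distrib : ∀ p q r → (p - q) * r ≡ p * r - q * r
      distrib = solve 3 (λ p q r → (p :- q) :* r := p :* r :- q :* r) refl
        where open +-*-Solver
      factor : ∀ p q r → p * q - p * r ≡ p * (q - r)
      factor = solve 3 (λ p q r → p :* q :- p :* r := p :* (q :- r)) refl
        where open +-*-Solver

  -- At `outer` the expected saving `Λ` pays for the draw itself and for the at most `suc K` digit
  -- draws it may open. At `refine` the reward part is conserved by `reward-refine`, and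
  -- `digitsLeft` falls by at least one.
  potential-drift : ∀ s → running s + 𝔼 potential (step s) ≤ potential s
  potential-drift outer = begin
    1ℚ + 𝔼 potential (step outer)
      ≡⟨ cong (λ z → 1ℚ + z) (𝔼-+ (reward (λ _ → 0ℚ) C) digitsLeft (step outer)) ⟩
    1ℚ + (𝔼 (reward (λ _ → 0ℚ) C) (step outer) + 𝔼 digitsLeft (step outer))
      ≤⟨ +-monoʳ-≤ 1ℚ (+-mono-≤ (≤-reflexive restart-outer)
           (𝔼-uniform-≤ (ΣA G) (λ k → scan scanOrder (suc k)) (λ k → digitsLeft-≤ (scan scanOrder (suc k))))) ⟩
    1ℚ + (C - Λ + fromℕ (suc K))
      ≡⟨ cancel 1ℚ C (fromℕ (suc K)) ⟩
    C + 0ℚ ∎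
    where
      open ≤-Reasoning
      cancel : ∀ p q r → p + (q - (p + r) + r) ≡ q + 0ℚ
      cancel p q r = trans (solve 3 (λ p q r → p :+ (q :- (p :+ r) :+ r) := q) refl p q r) (sym (+-identityʳ q))
        where open +-*-Solver
  potential-drift (refine i m) = begin
    1ℚ + 𝔼 potential (step (refine i m))
      ≡⟨ cong (λ z → 1ℚ + z) (𝔼-+ (reward (λ _ → 0ℚ) C) digitsLeft (step (refine i m))) ⟩
    1ℚ + (𝔼 (reward (λ _ → 0ℚ) C) (step (refine i m)) + 𝔼 digitsLeft (step (refine i m)))
      ≤⟨ +-monoʳ-≤ 1ℚ (+-mono-≤ (≤-reflexive (reward-refine (λ _ → 0ℚ) C i m))
           (𝔼-uniform-≤ B (compareDigit i m) (digitsLeft-compareDigit i m))) ⟩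
    1ℚ + (ρ + fromℕ (K ∸ m))
      ≡⟨ swap 1ℚ ρ (fromℕ (K ∸ m)) ⟩
    ρ + (1ℚ + fromℕ (K ∸ m))
      ≡⟨ cong (λ z → ρ + z) (fromℕ-suc (K ∸ m)) ⟨
    potential (refine i m) ∎
    where
      open ≤-Reasoning
      ρ = reward (λ _ → 0ℚ) C (refine i m)
      swap : ∀ p q r → p + (q + r) ≡ q + (p + r)
      swap = solve 3 (λ p q r → p :+ (q :+ r) := q :+ (p :+ r)) refl
        where open +-*-Solver
  potential-drift (returned i) = ≤-reflexive (trans (+-identityˡ _) (𝔼-dirac potential (returned i)))
  potential-drift stuck        = ≤-reflexive (trans (+-identityˡ _) (𝔼-dirac potential stuck))

  open Convergence step step-nonNeg outer run refl (λ _ → refl) using (absorption-limit)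

  -- The reward agrees with the indicator of `P` on stopped states and lies between 0 and 1 on
  -- running ones, as `absorption-limit` requires with `running` as the gap. The factor `exp2 G` is
  -- common to both sides of the balance, so the limit does not depend on the shift.
  return-probability : ∀ {P : State → Set} (P? : Decidable P) {u a} →
    (∀ i → indicator P? (returned i) ≡ u i) →
    indicator P? outer ≡ 0ℚ → (∀ i m → indicator P? (refine i m) ≡ 0ℚ) → indicator P? stuck ≡ 0ℚ →
    (∀ i → 0ℚ ≤ u i) → (∀ i → u i ≤ 1ℚ) → 0ℚ ≤ a → a ≤ 1ℚ →
    sum (λ i → W i * u i) ≡ ΣW * a →
    EventuallyWithProbability P? a
  return-probability P? {u} {a} P-returned P-outer P-refine P-stuck 0≤u u≤1 0≤a a≤1 ΣWu≡ΣWa =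
    absorption-limit running-decreasing potential-drift potential-nonNeg P?
      (reward-harmonic u a Σwu≡Ωa) lower upper
    where
      Σwu≡Ωa : sum (λ i → shiftedW i * u i) ≡ Ω * a
      Σwu≡Ωa = begin
        sum (λ i → W i * exp2 G * u i)    ≡⟨ sum-cong-≗ (λ i → swap (W i) (exp2 G) (u i)) ⟩
        sum (λ i → W i * u i * exp2 G)    ≡⟨ *-distribʳ-sum (exp2 G) (λ i → W i * u i) ⟨
        sum (λ i → W i * u i) * exp2 G    ≡⟨ cong (_* exp2 G) ΣWu≡ΣWa ⟩
        ΣW * a * exp2 G                   ≡⟨ swap ΣW a (exp2 G) ⟩
        ΣW * exp2 G * a                   ≡⟨ cong (_* a) Ω≡ ⟨
        Ω * a                             ∎
        where
          open ≡-Reasoning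
          swap : ∀ p q r → p * q * r ≡ p * r * q
          swap = solve 3 (λ p q r → p :* q :* r := p :* r :* q) refl
            where open +-*-Solver

      lower : ∀ s → indicator P? s ≤ reward u a s
      lower outer        = subst (_≤ a) (sym P-outer) 0≤a
      lower (refine i m) = subst (_≤ reward u a (refine i m)) (sym (P-refine i m)) (reward-nonNeg 0≤u 0≤a (refine i m))
      lower (returned i) = ≤-reflexive (P-returned i)
      lower stuck        = ≤-reflexive P-stuck

      upper : ∀ s → reward u a s ≤ indicator P? s + running s
      upper outer        = subst (λ z → a ≤ z + 1ℚ) (sym P-outer) a≤1
      upper (refine i m) = subst (λ z → reward u a (refine i m) ≤ z + 1ℚ) (sym (P-refine i m))
        (mixture-≤1 (frac-nonNeg (scaledSS i m * (+ 1 / B))) (frac-≤1 (scaledSS i m * (+ 1 / B))) (u≤1 i) a≤1)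
      upper (returned i) = ≤-reflexive (sym (trans (+-identityʳ _) (P-returned i)))
      upper stuck        = ≤-reflexive (sym (trans (+-identityʳ _) P-stuck))

  -- Termination and the output distribution

  terminates : TerminatesWithProbability 1ℚ
  -- Every return earns 1, and the balance Σ W = ΣW holds with a = 1.
  terminates = return-probability terminated? {u = λ _ → 1ℚ} (λ _ → refl) refl (λ _ _ → refl) refl
    (λ _ → 0≤1) (λ _ → ≤-refl) 0≤1 ≤-refl (sym (*-distribʳ-sum 1ℚ W))

  module _ (i : Fin N) where
    private
      instance
        ΣW-nonZero : ℚ.NonZero ΣW
        ΣW-nonZero = ΣW≢0 nonempty

      u : Fin N → ℚ
      -- Only a return of level i earns 1, so the weighted sum of rewards is `W i` and the balance
      -- forces a = W i / ΣW.
      u j = indicator (returned? i) (returned j)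

      ΣWu : sum (λ j → W j * u j) ≡ W i
      ΣWu = trans (sum-single (λ j → W j * u j) i off) on
        where
          off : ∀ j → j ≢ i → W j * u j ≡ 0ℚ
          off j j≢i = trans (cong (λ t → W j * (if t then 1ℚ else 0ℚ))
            (dec-false (returned? i (returned j)) λ { refl → j≢i refl })) (*-zeroʳ (W j))
          on : W i * u i ≡ W i
          on = trans (cong (λ t → W i * (if t then 1ℚ else 0ℚ)) (dec-true (returned? i (returned i)) refl)) (*-identityʳ (W i))

      W≤ΣW : W i ≤ ΣW
      W≤ΣW = begin
        W i                     ≡⟨ ΣWu ⟨
        sum (λ j → W j * u j)   ≤⟨ sum-mono (λ j → *-monoˡ (scaled-nonNeg (SS j) (level j)) (indicator-≤1 (returned? i) (returned j))) ⟩
        sum (λ j → W j * 1ℚ)    ≡⟨ sum-cong-≗ (λ j → *-identityʳ (W j)) ⟩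
        ΣW                      ∎
        where open ≤-Reasoning

      1/ΣW-nonNeg : 0ℚ ≤ 1/ ΣW
      1/ΣW-nonNeg = pos⇒0≤1/ ΣW

    returns : ReturnsWithProbability i (_÷_ (W i) ΣW {{ΣW≢0 nonempty}})
    returns = return-probability (returned? i) (λ _ → refl) refl (λ _ _ → refl) refl
      (λ j → indicator-nonNeg (returned? i) (returned j)) (λ j → indicator-≤1 (returned? i) (returned j))
      (*-nonNeg (scaled-nonNeg (SS i) (level i)) 1/ΣW-nonNeg)
      (subst (W i ÷ ΣW ≤_) (*-inverseʳ ΣW) (*-monoʳ-≤-nonNeg (1/ ΣW) {{nonNegative 1/ΣW-nonNeg}} W≤ΣW))
      (trans ΣWu (sym (*-÷-cancel (W i) ΣW)))

mainTheorem3 : ∀ (b : ℕ) → 2 ℕ.≤ b → (c : Config b) (nonempty : Config.Nonempty c) (G : ℤ) →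
  let open Config c
      open Sampler c G
  in TerminatesWithProbability 1ℚ
     × (∀ i → ReturnsWithProbability i (_÷_ (W i) ΣW {{ΣW≢0 nonempty}}))
mainTheorem3 b 2≤b c nonempty G = terminates , returns
  where open Lyapunov 2≤b c nonempty G
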